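{- There is an absolute constant $C>0$ such that for every positive integer $n$ divisible by $3$ and every integer $k\geq 3$ there exists a weight function $\tilde w: E_{k,n}\to\mathbb{R}_{\geq 0}$ such that (1) $\mathrm{LP}(\tilde w)\leq \frac{1}{6}\left(5+\frac{1}{k-1}\right) + C/n$, and (2) every $k$-way cut $P$ of $\Delta_{k,n}$ satisfies $\mathrm{cost}(P,\tilde w)\geq 1$.
   Context: For integers $k\ge 2$, $n \geq 1$: $\Delta_k=\{x\in[0,1]^k : \sum_i x_i = 1\}$, $e^i$ is the $i$-th standard basis vector, $\Delta_{k,n}$ is the set of points of $\Delta_k$ all of whose coordinates are multiples of $1/n$, and $E_{k,n}$ is the set of unordered pairs $\{x,y\}$ of points of $\Delta_{k,n}$ with $\|x-y\|_1 = 2/n$. For $w: E_{k,n}\to\mathbb{R}_{\ge 0}$, $\mathrm{LP}(w) = \frac1n\sum_{\{x,y\}\in E_{k,n}} w(x,y)$ (the value of the CKR relaxation at the solution assigning each point to itself). A $k$-way cut of $\Delta_{k,n}$ is a map $P:\Delta_{k,n}\to[k]$ with $P(e^i)=i$ for all $i\in[k]$, and $\mathrm{cost}(P,w)=\sum_{\{x,y\}\in E_{k,n}} w(x,y)\,\mathbf{1}[P(x)\neq P(y)]$. -}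

module Defs where

open import Data.Nat as ℕ using (ℕ; zero; suc; _≡ᵇ_; ∣_-_∣)
open import Data.Integer using (+_)
open import Data.Fin using (Fin; _≟_)
open import Data.Vec using (Vec; []; _∷_; tabulate; zipWith)
import Data.Vec as Vec
open import Data.List using (List; []; _∷_; map; concatMap; upTo; filterᵇ; _++_; foldr)
open import Data.Product using (_×_; _,_)
open import Relation.Binary.PropositionalEquality using (_≡_)
open import Data.Bool using (if_then_else_)
open import Relation.Nullary using (does)
open import Data.Rational using (ℚ; _/_; _+_; _*_; 0ℚ)

-- Points of Δ_{k,n} are represented by their scaled coordinates:
-- x ∈ Δ_{k,n} ↔ n·x ∈ ℕ^k with coordinate sum n.

comps : (k n : ℕ) → List (Vec ℕ k)
comps zero zero = [] ∷ []
comps zero (suc _) = []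
comps (suc k) n = concatMap (λ a → map (a ∷_) (comps k (n ℕ.∸ a))) (upTo (suc n))

Δpts : (k n : ℕ) → List (Vec ℕ k)
Δpts = comps

vertex : {k : ℕ} (n : ℕ) → Fin k → Vec ℕ k
vertex n i = tabulate (λ j → if does (j ≟ i) then n else 0)

dist1 : {k : ℕ} → Vec ℕ k → Vec ℕ k → ℕ
dist1 x y = Vec.sum (zipWith ∣_-_∣ x y)

pairsOf : {A : Set} → List A → List (A × A)
pairsOf [] = []
pairsOf (x ∷ xs) = map (x ,_) xs ++ pairsOf xs

-- E_{k,n}: unordered pairs {x,y} of Δ_{k,n} with ‖x-y‖₁ = 2/n, each listed once
Edges : (k n : ℕ) → List (Vec ℕ k × Vec ℕ k)
Edges k n = filterᵇ (λ { (x , y) → dist1 x y ≡ᵇ 2 }) (pairsOf (Δpts k n))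

sumℚ : List ℚ → ℚ
sumℚ = foldr _+_ 0ℚ

toℚ : ℕ → ℚ
toℚ m = + m / 1

-- reciprocal of a natural number (with 1/0 := 0; only used at nonzero arguments)
inv : ℕ → ℚ
inv zero = 0ℚ
inv (suc d) = + 1 / suc d

-- weight functions: values on pairs of (scaled) points; only values on edges matter
Weight : ℕ → Set
Weight k = Vec ℕ k → Vec ℕ k → ℚ

LP : (k n : ℕ) → Weight k → ℚ
LP k n w = inv n * sumℚ (map (λ { (x , y) → w x y }) (Edges k n))

-- k-way cut: P : Δ_{k,n} → [k] with P(e^i) = i
-- (P is given on all of ℕ^k; only its values on Δ_{k,n} matter)
Cut : (k n : ℕ) → Set
Cut k n = Vec ℕ k → Fin k

IsKWayCut : (k n : ℕ) → Cut k n → Set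
IsKWayCut k n P = ∀ (i : Fin k) → P (vertex n i) ≡ i

cost : (k n : ℕ) → Cut k n → Weight k → ℚ
cost k n P w = sumℚ (map (λ { (x , y) → if does (P x ≟ P y) then 0ℚ else w x y }) (Edges k n))

{-# OPTIONS --safe #-}
-- Let n = 3q. On each triangle of the simplex put weight 1 on all lattice edges, except that inside the corner
-- x_i > 2q the edges parallel to the opposite side are dropped, and add weight x_i - 2q on the sides at that corner.
-- Mixing these triangles with uniform weights on all segments [e_i, e_j] and normalising gives the LP value.
--
-- For the cut bound, recolour each corner by its own vertex: the row edges and the extra side weights pay
-- for this. If colour i occurs on the side opposite to e_i, replace it by an extra colour outside the corner;
-- this costs at most the level cut 2q, and it is compensated by the second colour change on that segment.
-- Now colour i never appears opposite to e_i. If every row x_i = s with s < q contains the extra colour, each of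
-- these 3q rows has two colour changes. Otherwise some row avoids it, and the extra colour can be absorbed on the
-- two sides of that row at no cost, leaving a Sperner colouring; such a colouring has at least n
-- non-monochromatic up-triangles (Mirzakhani and Vondrák). Either way the cost is at least 6q.
module Submission where

-- Without colour i opposite to e_i, a triangle costs at least 6q and its weight is 15q² + 3q, so
-- its ratio is 5/6 after division by n = 3q, up to O(1/n). The obstacle is colours of further
-- vertices. The segment [e_i, e_j] lies in k - 2 triangles, but a colour l on it spoils only the
-- one with third vertex e_l, and r further colours force r + 1 changes on the segment. Hence a
-- single copy of each segment, with weight 2q per edge, compensates all its triangles at once and
-- still has one change left. Per ordered pair there are thus k - 2 triangle directions of weight
-- 5q² + q each and a segment of weight 6q², while every cut costs at least 2q(k - 1). The leading
-- term of the LP value is ((k - 2) · 5/6 + 1)/(k - 1) = (5 + 1/(k - 1))/6. Corners of depth n/3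
-- balance the two cases of the cut bound: two changes in each of 3 · n/3 rows amount to 2n, which
-- is also the Sperner bound.

module Combinatorics where

  open import Data.Nat hiding (_≟_)
  open import Data.Nat.Properties hiding (_≟_)
  import Data.Nat.Properties as ℕ
  open import Data.Nat.Tactic.RingSolver using (solve-∀)
  open import Data.Fin using (Fin; zero; suc; _≟_)
  open import Data.Fin.Properties using () renaming (suc-injective to Fin-suc-injective)
  open import Data.Vec using (Vec; []; _∷_; tabulate)
  import Data.Vec as Vec
  open import Data.Vec.Properties using (tabulate-cong; ≡-dec; ∷-injectiveˡ; ∷-injectiveʳ)
  open import Data.List using (List; []; _∷_; map; concatMap; upTo; applyUpTo; filterᵇ; _++_)
  open import Data.Product using (∃; _×_; _,_; proj₁; proj₂)
  open import Data.Sum using (_⊎_; inj₁; inj₂; [_,_]′)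
  open import Data.Empty using (⊥; ⊥-elim)
  open import Data.Bool using (Bool; true; false; if_then_else_)
  open import Relation.Nullary using (Dec; yes; no; does; ¬_)
  open import Relation.Nullary.Decidable using (_×-dec_; dec-true; dec-false)
  open import Relation.Binary.PropositionalEquality hiding (J)
  open import Function using (flip; _∘_)
  open import Defs using (vertex; IsKWayCut; comps; pairsOf; Edges; dist1)

  -- Sums and Sperner colourings

  -- A m g is the sum of g a b over a + b ≡ m, and S m f the sum of f a b c over a + b + c ≡ m.
  A : ℕ → (ℕ → ℕ → ℕ) → ℕ
  A zero g = g 0 0
  A (suc m) g = g 0 (suc m) + A m (λ a b → g (suc a) b)

  S : ℕ → (ℕ → ℕ → ℕ → ℕ) → ℕ
  S m f = A m (λ a r → A r (f a))

  A-mono : ∀ m {f g} → (∀ a b → a + b ≡ m → f a b ≤ g a b) → A m f ≤ A m g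
  A-mono zero h = h 0 0 refl
  A-mono (suc m) h = +-mono-≤ (h 0 (suc m) refl) (A-mono m (λ a b e → h (suc a) b (cong suc e)))

  A-cong : ∀ m {f g} → (∀ a b → a + b ≡ m → f a b ≡ g a b) → A m f ≡ A m g
  A-cong m h = ≤-antisym (A-mono m (λ a b e → ≤-reflexive (h a b e)))
                         (A-mono m (λ a b e → ≤-reflexive (sym (h a b e))))

  A-zero : ∀ m → A m (λ _ _ → 0) ≡ 0
  A-zero zero = refl
  A-zero (suc m) = A-zero m

  A-one : ∀ m → A m (λ _ _ → 1) ≡ suc m
  A-one zero = refl
  A-one (suc m) = cong suc (A-one m)

  A-+ : ∀ m f g → A m (λ a b → f a b + g a b) ≡ A m f + A m g
  A-+ zero f g = refl
  A-+ (suc m) f g rewrite A-+ m (λ a b → f (suc a) b) (λ a b → g (suc a) b) =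
    lem (f 0 (suc m)) (g 0 (suc m)) (A m (λ a b → f (suc a) b)) _
    where
    lem : ∀ x y z t → x + y + (z + t) ≡ x + z + (y + t)
    lem = solve-∀

  A-* : ∀ m k f → A m (λ a b → k * f a b) ≡ k * A m f
  A-* zero k f = refl
  A-* (suc m) k f rewrite A-* m k (λ a b → f (suc a) b) =
    sym (*-distribˡ-+ k (f 0 (suc m)) _)

  A-last : ∀ m g → A (suc m) g ≡ A m (λ a b → g a (suc b)) + g (suc m) 0
  A-last zero g = refl
  A-last (suc m) g rewrite A-last m (λ a b → g (suc a) b) = sym (+-assoc (g 0 (suc (suc m))) _ _)

  A-swap : ∀ m g → A m g ≡ A m (flip g)
  A-swap zero g = refl
  A-swap (suc m) g = trans (A-last m g)
    (trans (+-comm _ (g (suc m) 0)) (cong (g (suc m) 0 +_) (A-swap m (λ a b → g a (suc b)))))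

  A-assoc : ∀ m f → S m f ≡ A m (λ s c → A s (λ a b → f a b c))
  A-assoc zero f = refl
  A-assoc (suc m) f = begin
    f 0 0 (suc m) + A m (λ b c → f 0 (suc b) c) + S m (λ a → f (suc a))
      ≡⟨ +-assoc (f 0 0 (suc m)) _ _ ⟩
    f 0 0 (suc m) + (A m (λ b c → f 0 (suc b) c) + S m (λ a → f (suc a)))
      ≡⟨ cong (λ z → f 0 0 (suc m) + (A m (λ b c → f 0 (suc b) c) + z)) (A-assoc m (λ a → f (suc a))) ⟩
    f 0 0 (suc m) + (A m (λ b c → f 0 (suc b) c) + A m (λ s c → A s (λ a b → f (suc a) b c)))
      ≡⟨ cong (f 0 0 (suc m) +_) (A-+ m _ _) ⟨
    _ ∎
    where open ≡-Reasoning

  S-mono : ∀ m {f g} → (∀ a b c → a + (b + c) ≡ m → f a b c ≤ g a b c) → S m f ≤ S m g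
  S-mono m h = A-mono m (λ a r e → A-mono r (λ b c e′ → h a b c (trans (cong (a +_) e′) e)))

  S-+ : ∀ m f g → S m (λ a b c → f a b c + g a b c) ≡ S m f + S m g
  S-+ m f g = trans (A-cong m (λ a r _ → A-+ r (f a) (g a))) (A-+ m _ _)

  S-* : ∀ m k f → S m (λ a b c → k * f a b c) ≡ k * S m f
  S-* m k f = trans (A-cong m (λ a r _ → A-* r k (f a))) (A-* m k _)

  rot : {B : Set} → (ℕ → ℕ → ℕ → B) → ℕ → ℕ → ℕ → B
  rot f x y z = f y z x

  -- `A-assoc` makes the last coordinate the outer one and `A-swap` turns it into the first. With
  -- this symmetry, estimates for edges parallel to one side transfer to the other two directions.
  S-rot : ∀ m f → S m f ≡ S m (rot f)
  S-rot m f = trans (A-assoc m f) (A-swap m _)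

  S-shift₁ : ∀ m f → (∀ b c → b + c ≡ suc m → f 0 b c ≡ 0) → S (suc m) f ≡ S m (λ a → f (suc a))
  S-shift₁ m f h = cong (_+ S m (λ a → f (suc a))) (trans (A-cong (suc m) h) (A-zero (suc m)))

  S-shift₃ : ∀ m f → (∀ a b → a + b ≡ suc m → f a b 0 ≡ 0) → S (suc m) f ≡ S m (λ a b c → f a b (suc c))
  S-shift₃ m f h = trans (S-rot (suc m) f)
    (trans (S-shift₁ m (rot f) h) (sym (S-rot m (λ a b c → f a b (suc c)))))

  S-shift₂ : ∀ m f → (∀ c a → c + a ≡ suc m → f a 0 c ≡ 0) → S (suc m) f ≡ S m (λ a b c → f a (suc b) c)
  S-shift₂ m f h = trans (S-rot (suc m) f)
    (trans (S-shift₃ m (rot f) h) (sym (S-rot m (λ a b c → f a (suc b) c))))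

  abstract
    -- Opaque, so that outside this block a `with x ≟ y` leaves `e x y` and `d x y` in place, to be
    -- rewritten by the lemmas below.
    e d : ∀ {k} → Fin k → Fin k → ℕ
    e x y = if does (x ≟ y) then 1 else 0
    d x y = if does (x ≟ y) then 0 else 1

    e-refl : ∀ {k} (x : Fin k) → e x x ≡ 1
    e-refl x with x ≟ x
    ... | yes _ = refl
    ... | no ne = ⊥-elim (ne refl)

    e-≢ : ∀ {k} {x y : Fin k} → x ≢ y → e x y ≡ 0
    e-≢ {x = x} {y} ne with x ≟ y
    ... | yes eq = ⊥-elim (ne eq)
    ... | no _ = refl

    d-refl : ∀ {k} (x : Fin k) → d x x ≡ 0
    d-refl x with x ≟ x
    ... | yes _ = refl
    ... | no ne = ⊥-elim (ne refl)

    d-≡ : ∀ {k} {x y : Fin k} → x ≡ y → d x y ≡ 0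
    d-≡ {x = x} refl = d-refl x

    d-≢ : ∀ {k} {x y : Fin k} → x ≢ y → d x y ≡ 1
    d-≢ {x = x} {y} ne with x ≟ y
    ... | yes eq = ⊥-elim (ne eq)
    ... | no _ = refl

    d≤1 : ∀ {k} (x y : Fin k) → d x y ≤ 1
    d≤1 x y with x ≟ y
    ... | yes _ = z≤n
    ... | no _ = ≤-refl

    e≤1 : ∀ {k} (x y : Fin k) → e x y ≤ 1
    e≤1 x y with x ≟ y
    ... | yes _ = ≤-refl
    ... | no _ = z≤n

    d-sym : ∀ {k} (x y : Fin k) → d x y ≡ d y x
    d-sym x y with x ≟ y
    ... | yes refl = sym (d-refl x)
    ... | no ne = sym (d-≢ (ne ∘ sym))

    d-triangle : ∀ {k} (x y z : Fin k) → d x z ≤ d x y + d y z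
    d-triangle x y z with x ≟ y
    ... | yes refl = ≤-refl
    ... | no _ = ≤-trans (d≤1 x z) (s≤s z≤n)

    d-map : ∀ {k l} (f : Fin k → Fin l) x y → d (f x) (f y) ≤ d x y
    d-map f x y with x ≟ y
    ... | yes refl = ≤-reflexive (d-refl (f x))
    ... | no _ = d≤1 (f x) (f y)

    e-disjoint : ∀ {k} (x : Fin k) {u v} → u ≢ v → e x u + e x v ≤ 1
    e-disjoint x {u} {v} ne with x ≟ u
    ... | yes refl rewrite e-≢ ne = ≤-refl
    ... | no _ = e≤1 x v

    e-def : ∀ {k} (x y : Fin k) → e x y ≡ (if does (x ≟ y) then 1 else 0)
    e-def x y = refl

  module _ {K : ℕ} where

    Path : Set
    Path = ℕ → ℕ → Fin K

    J : ℕ → Path → ℕ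
    J r X = A r (λ a b → d (X (suc a) b) (X a (suc b)))

    J-≢ : ∀ r (X : Path) a b → a + b ≡ suc r → X a b ≢ X (suc r) 0 → 1 ≤ J r X
    J-≢ zero X zero (suc zero) eq ne = ≤-reflexive (sym (d-≢ (ne ∘ sym)))
    J-≢ zero X (suc zero) zero eq ne = ⊥-elim (ne refl)
    J-≢ (suc r) X zero b refl ne with X 1 (suc r) ≟ X 0 (suc (suc r))
    ... | yes p = ≤-trans (J-≢ r (λ a b → X (suc a) b) 0 (suc r) refl (λ z → ne (trans (sym p) z))) (m≤n+m _ _)
    ... | no p = ≤-trans (≤-reflexive (sym (d-≢ p))) (m≤m+n _ _)
    J-≢ (suc r) X (suc a) b eq ne =
      ≤-trans (J-≢ r (λ a b → X (suc a) b) a b (suc-injective eq) ne) (m≤n+m _ _)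

    -- There is one change on either side of the point. The induction walks from the end
    -- `X 0 (suc r)` to the first change and leaves the rest of the path to `J-≢`.
    J-≢≢ : ∀ r (X : Path) a b → a + b ≡ suc r → X a b ≢ X (suc r) 0 → X a b ≢ X 0 (suc r) → 2 ≤ J r X
    J-≢≢ r X zero b refl ne₁ ne₂ = ⊥-elim (ne₂ refl)
    J-≢≢ zero X (suc zero) zero eq ne₁ ne₂ = ⊥-elim (ne₁ refl)
    J-≢≢ (suc r) X (suc a) b eq ne₁ ne₂ with X 1 (suc r) ≟ X 0 (suc (suc r))
    ... | yes p = ≤-trans (J-≢≢ r (λ a b → X (suc a) b) a b (suc-injective eq) ne₁ (λ z → ne₂ (trans z p))) (m≤n+m _ _)
    ... | no p = +-mono-≤ (≤-reflexive (sym (d-≢ p))) (J-≢ r (λ a b → X (suc a) b) a b (suc-injective eq) ne₁)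

    Colouring : Set
    Colouring = ℕ → ℕ → ℕ → Fin K

    -- Bichromatic edges parallel to the side opposite to the first vertex. Triples with sum `m`
    -- index the edges of a triangle of side `suc m`.
    Fam : ℕ → Colouring → ℕ
    Fam m Q = S m (λ a b c → d (Q a (suc b) c) (Q a b (suc c)))

    F : ℕ → Colouring → ℕ
    F m Q = Fam m Q + Fam m (rot Q) + Fam m (rot (rot Q))

    F-rot : ∀ m Q → F m (rot Q) ≡ F m Q
    F-rot m Q = trans (+-comm (Fam m (rot Q) + Fam m (rot (rot Q))) (Fam m Q)) (sym (+-assoc (Fam m Q) _ _))

    -- Each edge of the triangular grid lies in exactly one up-triangle with vertices (a+1,b,c),
    -- (a,b+1,c), (a,b,c+1).
    F-up : ∀ m Q → F m Q ≡ S m (λ a b c → d (Q a (suc b) c) (Q a b (suc c))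
      + d (Q (suc a) b c) (Q a (suc b) c) + d (Q a b (suc c)) (Q (suc a) b c))
    F-up m Q = trans (cong₂ (λ x y → Fam m Q + x + y) (sym (S-rot m _)) (sym (trans (S-rot m _) (S-rot m _))))
      (sym (trans (S-+ m _ _) (cong (_+ S m (λ a b c → d (Q a b (suc c)) (Q (suc a) b c))) (S-+ m _ _))))

    mono : Colouring → Fin K → ℕ → ℕ → ℕ → ℕ
    mono Q u a b c = e (Q (suc a) b c) u * (e (Q a (suc b) c) u * e (Q a b (suc c)) u)

    module Sperner (u₁ u₂ u₃ : Fin K) (u₁₂ : u₁ ≢ u₂) (u₂₃ : u₂ ≢ u₃) (u₁₃ : u₁ ≢ u₃) where

      SpernerAt : Colouring → ℕ → ℕ → ℕ → Set
      SpernerAt Q a b c = (Q a b c ≡ u₁ × 0 < a) ⊎ (Q a b c ≡ u₂ × 0 < b) ⊎ (Q a b c ≡ u₃ × 0 < c)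

      -- Here `x`, `y`, `z` are to be the colours at r+e₁+e₂, r+e₁+e₃, r+e₂+e₃, the vertices of a
      -- down-triangle. Any two of the products demand different colours at a common vertex, so at
      -- most one is nonzero.
      ind-product : ∀ x y z → e x u₁ * e y u₁ + e x u₂ * e z u₂ + e y u₃ * e z u₃ ≤ 1
      ind-product x y z with x ≟ u₁
      ... | yes refl rewrite e-refl x | e-≢ u₁₂ | +-identityʳ (e y x) | +-identityʳ (e y x) =
        ≤-trans (+-monoʳ-≤ (e y x) (≤-trans (*-monoʳ-≤ (e y u₃) (e≤1 z u₃)) (≤-reflexive (*-identityʳ _))))
          (e-disjoint y u₁₃)
      ... | no p rewrite e-≢ p = ≤-trans (+-mono-≤ (m*n≤n′ (e≤1 x u₂)) (m*n≤n′ (e≤1 y u₃))) (e-disjoint z u₂₃)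
        where
        m*n≤n′ : ∀ {m n} → m ≤ 1 → m * n ≤ n
        m*n≤n′ {m} {n} h = ≤-trans (*-monoˡ-≤ n h) (≤-reflexive (*-identityˡ n))

      -- Equality is transitive, so a triangle never has exactly one bichromatic edge: it has at
      -- least two or is monochromatic, and then the doubled term pays.
      cost-up : ∀ x y z → x ≡ u₁ ⊎ x ≡ u₂ ⊎ x ≡ u₃ →
        2 ≤ d y z + d x y + d z x + 2 * (e x u₁ * (e y u₁ * e z u₁) + e x u₂ * (e y u₂ * e z u₂)
          + e x u₃ * (e y u₃ * e z u₃))
      cost-up x y z h with x ≟ y | y ≟ z | z ≟ x
      ... | no p | no q | _ rewrite d-≢ p | d-≢ q = s≤s (s≤s z≤n)
      ... | no p | yes _ | no r rewrite d-≢ p | d-≢ r =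
        ≤-trans (+-monoˡ-≤ 1 (m≤n+m 1 (d y z))) (m≤m+n (d y z + 1 + 1) _)
      ... | yes _ | no q | no r rewrite d-≢ q | d-≢ r =
        ≤-trans (+-monoˡ-≤ 1 (s≤s z≤n)) (m≤m+n (1 + d x y + 1) _)
      ... | no p | yes q | yes r = ⊥-elim (p (sym (trans q r)))
      ... | yes p | no q | yes r = ⊥-elim (q (sym (trans r p)))
      ... | yes p | yes q | no r = ⊥-elim (r (sym (trans p q)))
      ... | yes refl | yes refl | yes _ with h
      ... | inj₁ refl rewrite e-refl x = ≤-trans (*-monoʳ-≤ 2 (s≤s z≤n)) (m≤n+m _ (d x x + d x x + d x x))
      ... | inj₂ (inj₁ refl) rewrite e-refl x = ≤-trans (*-monoʳ-≤ 2 {1}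
        (≤-trans (m≤n+m 1 (e x u₁ * (e x u₁ * e x u₁))) (m≤m+n _ (e x u₃ * (e x u₃ * e x u₃))))) (m≤n+m _ (d x x + d x x + d x x))
      ... | inj₂ (inj₂ refl) rewrite e-refl x = ≤-trans (*-monoʳ-≤ 2 {1}
        (m≤n+m 1 (e x u₁ * (e x u₁ * e x u₁) + e x u₂ * (e x u₂ * e x u₂)))) (m≤n+m _ (d x x + d x x + d x x))

      -- A monochromatic up-triangle of colour i with corner p has p_i > 0, and p - e_i determines it:
      -- p = r + e_i and p' = r + e_j would share the vertex r + e_i + e_j.
      sperner-cost : ∀ m Q → (∀ a b c → a + (b + c) ≡ suc (suc m) → SpernerAt Q a b c) →
        2 * suc (suc m) ≤ F (suc m) Q
      sperner-cost m Q sp = +-cancelʳ-≤ (2 * S m (λ _ _ _ → 1)) _ _ (begin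
        2 * suc (suc m) + 2 * S m (λ _ _ _ → 1)
          ≡⟨ *-distribˡ-+ 2 (suc (suc m)) _ ⟨
        2 * (suc (suc m) + S m (λ _ _ _ → 1))
          -- The row `a = 0` holds n up-triangles; the remaining ones correspond to the triples with
          -- sum `m`.
          ≡⟨ cong (λ z → 2 * (z + S m (λ _ _ _ → 1))) (A-one (suc m)) ⟨
        2 * S (suc m) (λ _ _ _ → 1)
          ≡⟨ S-*2 ⟨
        S (suc m) (λ _ _ _ → 2)
          ≤⟨ S-mono (suc m) (λ a b c eq → cost-up (Q (suc a) b c) (Q a (suc b) c) (Q a b (suc c)) (colour a b c eq)) ⟩
        S (suc m) (λ a b c → up a b c + 2 * (M₁ a b c + M₂ a b c + M₃ a b c))
          ≡⟨ S-+ (suc m) up (λ a b c → 2 * (M a b c)) ⟩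
        S (suc m) up + S (suc m) (λ a b c → 2 * (M₁ a b c + M₂ a b c + M₃ a b c))
          ≡⟨ cong₂ _+_ (sym (F-up (suc m) Q)) (S-* (suc m) 2 M) ⟩
        F (suc m) Q + 2 * S (suc m) (λ a b c → M₁ a b c + M₂ a b c + M₃ a b c)
          ≤⟨ +-monoʳ-≤ (F (suc m) Q) (*-monoʳ-≤ 2 mono-count) ⟩
        F (suc m) Q + 2 * S m (λ _ _ _ → 1) ∎)
        where
        open ≤-Reasoning
        M₁ M₂ M₃ M up : ℕ → ℕ → ℕ → ℕ
        M₁ = mono Q u₁
        M₂ = mono Q u₂
        M₃ = mono Q u₃
        M a b c = M₁ a b c + M₂ a b c + M₃ a b c
        up a b c = d (Q a (suc b) c) (Q a b (suc c)) + d (Q (suc a) b c) (Q a (suc b) c) + d (Q a b (suc c)) (Q (suc a) b c)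
        S-*2 : S (suc m) (λ _ _ _ → 2) ≡ 2 * S (suc m) (λ _ _ _ → 1)
        S-*2 = S-* (suc m) 2 (λ _ _ _ → 1)
        colour : ∀ a b c → a + (b + c) ≡ suc m → Q (suc a) b c ≡ u₁ ⊎ Q (suc a) b c ≡ u₂ ⊎ Q (suc a) b c ≡ u₃
        colour a b c eq with sp (suc a) b c (cong suc eq)
        ... | inj₁ (p , _) = inj₁ p
        ... | inj₂ (inj₁ (p , _)) = inj₂ (inj₁ p)
        ... | inj₂ (inj₂ (p , _)) = inj₂ (inj₂ p)
        ne₁ : ∀ b c → b + c ≡ suc (suc m) → Q 0 b c ≢ u₁
        ne₁ b c eq p with sp 0 b c eq
        ... | inj₂ (inj₁ (p′ , _)) = u₁₂ (trans (sym p) p′)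
        ... | inj₂ (inj₂ (p′ , _)) = u₁₃ (trans (sym p) p′)
        ne₂ : ∀ c a → c + a ≡ suc (suc m) → Q a 0 c ≢ u₂
        ne₂ c a eq p with sp a 0 c (trans (+-comm a c) eq)
        ... | inj₁ (p′ , _) = u₁₂ (trans (sym p′) p)
        ... | inj₂ (inj₂ (p′ , _)) = u₂₃ (trans (sym p) p′)
        ne₃ : ∀ a b → a + b ≡ suc (suc m) → Q a b 0 ≢ u₃
        ne₃ a b eq p with sp a b 0 (trans (cong (a +_) (+-identityʳ b)) eq)
        ... | inj₁ (p′ , _) = u₁₃ (trans (sym p′) p)
        ... | inj₂ (inj₁ (p′ , _)) = u₂₃ (trans (sym p′) p)
        z₁ : ∀ b c → b + c ≡ suc m → M₁ 0 b c ≡ 0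
        z₁ b c eq rewrite e-≢ (ne₁ (suc b) c (cong suc eq)) = *-zeroʳ (e (Q 1 b c) u₁)
        z₂ : ∀ c a → c + a ≡ suc m → M₂ a 0 c ≡ 0
        z₂ c a eq rewrite e-≢ (ne₂ c (suc a) (trans (+-suc c a) (cong suc eq))) = refl
        z₃ : ∀ a b → a + b ≡ suc m → M₃ a b 0 ≡ 0
        z₃ a b eq rewrite e-≢ (ne₃ (suc a) b (cong suc eq)) = refl
        drop : ∀ {x y z} → x ≤ 1 → x * (y * z) ≤ y * z
        drop {y = y} {z} h = ≤-trans (*-monoˡ-≤ (y * z) h) (≤-reflexive (*-identityˡ (y * z)))
        swap₂ : ∀ x y z → x * (y * z) ≡ y * (x * z)
        swap₂ = solve-∀
        swap₃ : ∀ x y z → x * (y * z) ≡ z * (x * y)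
        swap₃ = solve-∀
        mono-count : S (suc m) (λ a b c → M₁ a b c + M₂ a b c + M₃ a b c) ≤ S m (λ _ _ _ → 1)
        mono-count = begin
          S (suc m) (λ a b c → M₁ a b c + M₂ a b c + M₃ a b c)
            ≡⟨ trans (S-+ (suc m) (λ a b c → M₁ a b c + M₂ a b c) M₃) (cong (_+ S (suc m) M₃) (S-+ (suc m) M₁ M₂)) ⟩
          S (suc m) M₁ + S (suc m) M₂ + S (suc m) M₃
            ≡⟨ cong₂ _+_ (cong₂ _+_ (S-shift₁ m M₁ z₁) (S-shift₂ m M₂ z₂)) (S-shift₃ m M₃ z₃) ⟩
          S m (λ a → M₁ (suc a)) + S m (λ a b → M₂ a (suc b)) + S m (λ a b c → M₃ a b (suc c))
            ≡⟨ trans (S-+ m (λ a b c → M₁ (suc a) b c + M₂ a (suc b) c) (λ a b c → M₃ a b (suc c)))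
                 (cong (_+ S m (λ a b c → M₃ a b (suc c))) (S-+ m (λ a → M₁ (suc a)) (λ a b → M₂ a (suc b)))) ⟨
          S m (λ a b c → M₁ (suc a) b c + M₂ a (suc b) c + M₃ a b (suc c))
            -- Of each monochromatic triangle only the two vertices on the down-triangle of r =
            -- (a,b,c) are kept, which brings the sum into the form of `ind-product`.
            ≤⟨ S-mono m (λ a b c _ → ≤-trans
                 (+-mono-≤ (+-mono-≤ (drop {y = e (Q (suc a) (suc b) c) u₁} (e≤1 (Q (suc (suc a)) b c) u₁))
                   (≤-trans (≤-reflexive (swap₂ (e (Q (suc a) (suc b) c) u₂) (e (Q a (suc (suc b)) c) u₂) (e (Q a (suc b) (suc c)) u₂)))
                     (drop {y = e (Q (suc a) (suc b) c) u₂} (e≤1 (Q a (suc (suc b)) c) u₂))))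
                   (≤-trans (≤-reflexive (swap₃ (e (Q (suc a) b (suc c)) u₃) (e (Q a (suc b) (suc c)) u₃) (e (Q a b (suc (suc c))) u₃)))
                     (drop {y = e (Q (suc a) b (suc c)) u₃} (e≤1 (Q a b (suc (suc c))) u₃))))
                 (ind-product (Q (suc a) (suc b) c) (Q (suc a) b (suc c)) (Q a (suc b) (suc c)))) ⟩
          S m (λ _ _ _ → 1) ∎

  -- Colourings with an extra colour

  A-lower : ∀ q m g → q ≤ suc m → (∀ a r → a + r ≡ m → a < q → 2 ≤ g a r) → 2 * q ≤ A m g
  A-lower zero m g le h = z≤n
  A-lower (suc zero) zero g le h = h 0 0 refl (s≤s z≤n)
  A-lower (suc (suc q)) zero g (s≤s ()) h
  A-lower (suc q) (suc m) g (s≤s le) h = ≤-trans (≤-reflexive (*-suc 2 q))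
    (+-mono-≤ (h 0 (suc m) refl (s≤s z≤n))
      (A-lower q m (λ a → g (suc a)) le (λ a r eq lt → h (suc a) r (cong suc eq) (s≤s lt))))

  *3≡++ : ∀ q → q * 3 ≡ q + q + q
  *3≡++ = solve-∀

  rot-sum : ∀ x y z {n} → x + (y + z) ≡ n → y + (z + x) ≡ n
  rot-sum x y z eq = trans (lem x y z) eq
    where
    lem : ∀ x y z → y + (z + x) ≡ x + (y + z)
    lem = solve-∀

  module _ {K : ℕ} (n θ : ℕ) (u₄ : Fin K) where

    -- `u₄` acts as a joker: it is exempt from Sperner's condition, while the corner fields fix the
    -- colours of the three corners.
    record Good (u₁ u₂ u₃ : Fin K) (Q : Colouring) : Set where
      field
        corner₁ : ∀ a b c → a + (b + c) ≡ n → θ < a → Q a b c ≡ u₁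
        corner₂ : ∀ a b c → a + (b + c) ≡ n → θ < b → Q a b c ≡ u₂
        corner₃ : ∀ a b c → a + (b + c) ≡ n → θ < c → Q a b c ≡ u₃
        valid : ∀ a b c → a + (b + c) ≡ n →
          ((Q a b c ≡ u₁ × 0 < a) ⊎ (Q a b c ≡ u₂ × 0 < b) ⊎ (Q a b c ≡ u₃ × 0 < c)) ⊎ Q a b c ≡ u₄

    rot-Good : ∀ {u₁ u₂ u₃ Q} → Good u₁ u₂ u₃ Q → Good u₃ u₁ u₂ (rot Q)
    rot-Good {Q = Q} G = record
      { corner₁ = λ x y z eq → corner₃ y z x (rot-sum x y z eq)
      ; corner₂ = λ x y z eq → corner₁ y z x (rot-sum x y z eq)
      ; corner₃ = λ x y z eq → corner₂ y z x (rot-sum x y z eq)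
      ; valid = λ x y z eq → turn (valid y z x (rot-sum x y z eq))
      }
      where
      open Good G
      turn : ∀ {A B C D : Set} → (A ⊎ B ⊎ C) ⊎ D → (C ⊎ A ⊎ B) ⊎ D
      turn (inj₁ (inj₁ x)) = inj₁ (inj₂ (inj₁ x))
      turn (inj₁ (inj₂ (inj₁ x))) = inj₁ (inj₂ (inj₂ x))
      turn (inj₁ (inj₂ (inj₂ x))) = inj₁ (inj₁ x)
      turn (inj₂ x) = inj₂ x

    HasRow : Colouring → ℕ → Set
    HasRow Q a = ∃ λ b → b < suc n × (a + b ≤ n × Q a b (n ∸ (a + b)) ≡ u₄)

    hasRow? : ∀ Q a → Dec (HasRow Q a)
    hasRow? Q a = anyUpTo? (λ b → (a + b ≤? n) ×-dec (Q a b (n ∸ (a + b)) ≟ u₄)) (suc n)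

    noRow : ∀ Q a → ¬ HasRow Q a → ∀ b c → a + (b + c) ≡ n → Q a b c ≢ u₄
    noRow Q a nr b c refl p = nr (b , s≤s (≤-trans (m≤m+n b c) (m≤n+m _ a)) , ab≤n ,
      trans (cong (Q a b) (trans (cong (_∸ (a + b)) (sym (+-assoc a b c))) (m+n∸m≡n (a + b) c))) p)
      where
      ab≤n : a + b ≤ a + (b + c)
      ab≤n = +-monoʳ-≤ a (m≤m+n b c)

    findRow : ∀ Q q → (∀ a → a < q → HasRow Q a) ⊎ (∃ λ a → a < q × ¬ HasRow Q a)
    findRow Q zero = inj₁ (λ _ ())
    findRow Q (suc q) with findRow Q q | hasRow? Q q
    ... | inj₂ (a , lt , nr) | _ = inj₂ (a , m≤n⇒m≤1+n lt , nr)
    ... | inj₁ h | no ¬p = inj₂ (q , ≤-refl , ¬p)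
    ... | inj₁ h | yes p = inj₁ (λ a lt → [ (λ { a<q → h a a<q }) , (λ { refl → p }) ]′ (m<1+n⇒m<n∨m≡n lt))

  record Distinct {K : ℕ} (u₁ u₂ u₃ u₄ : Fin K) : Set where
    constructor distinct
    field
      u₁₂ : u₁ ≢ u₂
      u₂₃ : u₂ ≢ u₃
      u₁₃ : u₁ ≢ u₃
      u₁₄ : u₁ ≢ u₄
      u₂₄ : u₂ ≢ u₄
      u₃₄ : u₃ ≢ u₄

  rot-Distinct : ∀ {K} {u₁ u₂ u₃ u₄ : Fin K} → Distinct u₁ u₂ u₃ u₄ → Distinct u₃ u₁ u₂ u₄
  rot-Distinct D = distinct (u₁₃ ∘ sym) u₁₂ (u₂₃ ∘ sym) u₃₄ u₁₄ u₂₄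
    where open Distinct D

  module Extra {K : ℕ} (q m : ℕ) (mq : suc (suc m) ≡ q + q + q) (u₁ u₂ u₃ u₄ : Fin K) (D : Distinct u₁ u₂ u₃ u₄) where

    open Distinct D

    private
      n θ : ℕ
      n = suc (suc m)
      θ = q + q

    θ< : ∀ a b → a + b ≡ n → a < q → θ < b
    θ< a b eq lt = +-cancelˡ-< a θ b (<-≤-trans (+-monoˡ-< θ lt)
      (≤-reflexive (trans (+-comm q θ) (trans (sym mq) (sym eq)))))

    -- By `θ<` a row at level below `q` ends in the corners coloured `u₂` and `u₃`, so a point
    -- coloured `u₄` on it differs from both ends.
    fam-lower : ∀ Q → Good n θ u₄ u₁ u₂ u₃ Q → (∀ a → a < q → HasRow n θ u₄ Q a) → 2 * q ≤ Fam (suc m) Q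
    fam-lower Q G rows = A-lower q (suc m) (λ a r → J r (Q a)) q≤n row
      where
      open Good G
      q≤n : q ≤ suc (suc m)
      q≤n = ≤-trans (m≤n+m q θ) (≤-reflexive (sym mq))
      row : ∀ a r → a + r ≡ suc m → a < q → 2 ≤ J r (Q a)
      row a r eq lt with rows a lt
      ... | b , _ , le , p = J-≢≢ r (Q a) b (n ∸ (a + b)) bc
        (λ z → u₂₄ (trans (sym (corner₂ a (suc r) 0 (trans (cong (a +_) (+-identityʳ (suc r))) ar) (θ< a (suc r) ar lt)))
          (trans (sym z) p)))
        (λ z → u₃₄ (trans (sym (corner₃ a 0 (suc r) ar (θ< a (suc r) ar lt))) (trans (sym z) p)))
        where
        ar : a + suc r ≡ n
        ar = trans (+-suc a r) (cong suc eq)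
        bc : b + (n ∸ (a + b)) ≡ suc r
        bc = +-cancelˡ-≡ a _ _ (trans (sym (+-assoc a b _)) (trans (m+[n∸m]≡n le) (sym ar)))

    module Recolour (Q : Colouring) (G : Good n θ u₄ u₁ u₂ u₃ Q) (a₀ : ℕ) (a₀<q : a₀ < q)
      (no-u₄ : ∀ b c → a₀ + (b + c) ≡ n → Q a₀ b c ≢ u₄) where

      open Good G
      open Sperner u₁ u₂ u₃ u₁₂ u₂₃ u₁₃

      -- The row `a₀` separates the points coloured `u₄`: those between it and the side opposite to
      -- the first vertex become `u₂`, those beyond it `u₁`.
      side : ℕ → Fin K
      side a = if does (a <? a₀) then u₂ else u₁

      side-< : ∀ {a} → a < a₀ → side a ≡ u₂
      side-< {a} lt rewrite dec-true (a <? a₀) lt = refl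

      side-≥ : ∀ {a} → a₀ ≤ a → side a ≡ u₁
      side-≥ {a} ge rewrite dec-false (a <? a₀) (≤⇒≯ ge) = refl

      z : Colouring
      z a b c = if does (Q a b c ≟ u₄) then side a else Q a b c

      -- Adjacent points differ by at most one in level, so they cannot lie strictly on different
      -- sides of `a₀`. This is why absorbing `u₄` creates no new bichromatic edge.
      near : ∀ a a′ → a ≤ suc a′ → a′ ≤ suc a → a ≢ a₀ → a′ ≢ a₀ → side a ≡ side a′
      near a a′ h h′ ne ne′ with <-≤-connex a a₀ | <-≤-connex a′ a₀
      ... | inj₁ p | inj₁ r = trans (side-< p) (sym (side-< r))
      ... | inj₂ p | inj₂ r = trans (side-≥ p) (sym (side-≥ r))
      ... | inj₁ p | inj₂ r = ⊥-elim (ne′ (≤-antisym (≤-trans h′ p) r))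
      ... | inj₂ r | inj₁ p = ⊥-elim (ne (≤-antisym (≤-trans h p) r))

      z-edge : ∀ a b c a′ b′ c′ → a + (b + c) ≡ n → a′ + (b′ + c′) ≡ n → a ≤ suc a′ → a′ ≤ suc a →
        d (z a b c) (z a′ b′ c′) ≤ d (Q a b c) (Q a′ b′ c′)
      z-edge a b c a′ b′ c′ eq eq′ h h′ with Q a b c ≟ Q a′ b′ c′
      ... | no ne = ≤-trans (d≤1 _ _) (≤-reflexive (sym (d-≢ ne)))
      ... | yes p = ≤-trans (≤-reflexive (d-≡ same)) z≤n
        where
        same : z a b c ≡ z a′ b′ c′
        same with Q a b c ≟ u₄ | Q a′ b′ c′ ≟ u₄
        ... | no _ | no _ = p
        ... | yes r | no s = ⊥-elim (s (trans (sym p) r))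
        ... | no r | yes s = ⊥-elim (r (trans p s))
        ... | yes r | yes s = near a a′ h h′ (λ { refl → no-u₄ b c eq r }) (λ { refl → no-u₄ b′ c′ eq′ s })

      -- A point below `a₀` with `b = 0` has `c > θ` and is therefore coloured `u₃`, so `u₂` is
      -- admissible there. From `a₀` on, `a = 0` would put the point on the row `a₀`, which avoids
      -- `u₄`, so `u₁` is admissible.
      z-sperner : ∀ a b c → a + (b + c) ≡ n → SpernerAt z a b c
      z-sperner a b c eq with valid a b c eq | Q a b c ≟ u₄
      ... | inj₁ h | no _ = h
      ... | inj₂ p | no ne = ⊥-elim (ne p)
      ... | _ | yes p with <-≤-connex a a₀
      ... | inj₁ lt = inj₂ (inj₁ (side-< lt , n≢0⇒n>0 (λ { refl →
        u₃₄ (trans (sym (corner₃ a 0 c eq (θ< a c eq (<-trans lt a₀<q)))) p) })))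
      ... | inj₂ ge = inj₁ (side-≥ ge , n≢0⇒n>0 (λ a≡0 →
        no-u₄ b c (trans (cong (_+ (b + c)) (at-row a≡0)) eq) (subst (λ t → Q t b c ≡ u₄) (sym (at-row a≡0)) p)))
        where
        at-row : a ≡ 0 → a₀ ≡ a
        at-row a≡0 = ≤-antisym ge (≤-trans (≤-reflexive a≡0) z≤n)

      cost≤ : F (suc m) z ≤ F (suc m) Q
      cost≤ = +-mono-≤ (+-mono-≤
        (S-mono (suc m) (λ a b c eq → z-edge a (suc b) c a b (suc c) (p₂ a b c eq) (p₃ a b c eq) (n≤1+n a) (n≤1+n a)))
        (S-mono (suc m) (λ x y w eq → z-edge (suc y) w x y (suc w) x (q₁ x y w eq) (q₂ x y w eq) ≤-refl (m≤n⇒m≤1+n (n≤1+n y)))))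
        (S-mono (suc m) (λ x y w eq → z-edge w x (suc y) (suc w) x y (r₃ x y w eq) (r₁ x y w eq) (m≤n⇒m≤1+n (n≤1+n w)) ≤-refl))
        where
        p₂ : ∀ a b c → a + (b + c) ≡ suc m → a + (suc b + c) ≡ n
        p₂ a b c eq = trans (+-suc a (b + c)) (cong suc eq)
        p₃ : ∀ a b c → a + (b + c) ≡ suc m → a + (b + suc c) ≡ n
        p₃ a b c eq = trans (cong (a +_) (+-suc b c)) (p₂ a b c eq)
        q₁ : ∀ x y w → x + (y + w) ≡ suc m → suc y + (w + x) ≡ n
        q₁ x y w eq = cong suc (rot-sum x y w eq)
        q₂ : ∀ x y w → x + (y + w) ≡ suc m → y + (suc w + x) ≡ n
        q₂ x y w eq = p₂ y w x (rot-sum x y w eq)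
        r₁ : ∀ x y w → x + (y + w) ≡ suc m → suc w + (x + y) ≡ n
        r₁ x y w eq = cong suc (rot-sum y w x (rot-sum x y w eq))
        r₃ : ∀ x y w → x + (y + w) ≡ suc m → w + (x + suc y) ≡ n
        r₃ x y w eq = p₃ w x y (rot-sum y w x (rot-sum x y w eq))

    dichotomy : ∀ Q → Good n θ u₄ u₁ u₂ u₃ Q → 2 * q ≤ Fam (suc m) Q ⊎ 2 * (q + q + q) ≤ F (suc m) Q
    dichotomy Q G with findRow n θ u₄ Q q
    ... | inj₁ rows = inj₁ (fam-lower Q G rows)
    ... | inj₂ (a , lt , nr) = inj₂ (subst (λ t → 2 * t ≤ F (suc m) Q) mq
      (≤-trans (Sperner.sperner-cost u₁ u₂ u₃ u₁₂ u₂₃ u₁₃ m R.z R.z-sperner) R.cost≤))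
      where module R = Recolour Q G a lt (noRow n θ u₄ Q a nr)

  -- The Sperner bound found for any one direction is enough, since `F` is invariant under rotation.
  -- Otherwise each of the three directions contributes 2q on its own edges.
  good-cost : ∀ {K} q m → suc (suc m) ≡ q + q + q → (u₁ u₂ u₃ u₄ : Fin K) → Distinct u₁ u₂ u₃ u₄ →
    ∀ Q → Good (suc (suc m)) (q + q) u₄ u₁ u₂ u₃ Q → 2 * (q + q + q) ≤ F (suc m) Q
  good-cost q m mq u₁ u₂ u₃ u₄ D Q G
    with Extra.dichotomy q m mq u₁ u₂ u₃ u₄ D Q G
       | Extra.dichotomy q m mq u₃ u₁ u₂ u₄ (rot-Distinct D) (rot Q) (rot-Good (suc (suc m)) (q + q) u₄ G)
       | Extra.dichotomy q m mq u₂ u₃ u₁ u₄ (rot-Distinct (rot-Distinct D)) (rot (rot Q))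
           (rot-Good (suc (suc m)) (q + q) u₄ (rot-Good (suc (suc m)) (q + q) u₄ G))
  ... | inj₂ h | _ | _ = h
  ... | inj₁ _ | inj₂ h | _ = subst (2 * (q + q + q) ≤_) (F-rot (suc m) Q) h
  ... | inj₁ _ | inj₁ _ | inj₂ h = subst (2 * (q + q + q) ≤_) (trans (F-rot (suc m) (rot Q)) (F-rot (suc m) Q)) h
  ... | inj₁ h₁ | inj₁ h₂ | inj₁ h₃ = ≤-trans (≤-reflexive (lem q)) (+-mono-≤ (+-mono-≤ h₁ h₂) h₃)
    where
    lem : ∀ q → 2 * (q + q + q) ≡ 2 * q + 2 * q + 2 * q
    lem = solve-∀

  -- The weighted triangle

  -- Indicators of `t < x` and `x ≤ t` as numbers, to serve as weights.
  gt le : ℕ → ℕ → ℕ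
  gt zero _ = 0
  gt (suc x) zero = 1
  gt (suc x) (suc t) = gt x t
  le zero _ = 1
  le (suc x) zero = 0
  le (suc x) (suc t) = le x t

  gt-yes : ∀ {x t} → t < x → gt x t ≡ 1
  gt-yes {suc x} {zero} _ = refl
  gt-yes {suc x} {suc t} (s≤s h) = gt-yes h

  le-yes : ∀ {x t} → x ≤ t → le x t ≡ 1
  le-yes {zero} _ = refl
  le-yes {suc x} {suc t} (s≤s h) = le-yes h

  gt-∸ : ∀ c t → gt (suc c) t + (c ∸ t) ≡ suc c ∸ t
  gt-∸ c zero = refl
  gt-∸ zero (suc t) = sym (0∸n≡0 t)
  gt-∸ (suc c) (suc t) = gt-∸ c t

  A-gt : ∀ m t → A m (λ a r → gt (suc r) t) ≡ suc m ∸ t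
  A-gt zero zero = refl
  A-gt zero (suc t) = sym (0∸n≡0 t)
  A-gt (suc m) t = trans (cong (gt (suc (suc m)) t +_) (A-gt m t)) (gt-∸ (suc m) t)

  module _ {K : ℕ} where

    J-cong : ∀ r {X Y : Path {K}} → (∀ a b → a + b ≡ suc r → X a b ≡ Y a b) → J r X ≡ J r Y
    J-cong r h = A-cong r (λ a b eq → cong₂ d (h (suc a) b (cong suc eq)) (h a (suc b) (trans (+-suc a b) (cong suc eq))))

    J-flip : ∀ r (X : Path {K}) → J r X ≡ J r (flip X)
    J-flip r X = trans (A-swap r _) (A-cong r (λ a b _ → d-sym _ _))

    overwrite : ℕ → Fin K → Path {K} → Path {K}
    overwrite t p X a b = if does (t <? b) then p else X a b

    overwrite-> : ∀ {t p X a b} → t < b → overwrite t p X a b ≡ p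
    overwrite-> {t} {b = b} h rewrite dec-true (t <? b) h = refl

    overwrite-≤ : ∀ {t p X a b} → b ≤ t → overwrite t p X a b ≡ X a b
    overwrite-≤ {t} {b = b} h rewrite dec-false (t <? b) (≤⇒≯ h) = refl

    overwrite-none : ∀ r t p (X : Path {K}) → suc r ≤ t → J r (overwrite t p X) ≡ J r X
    overwrite-none r t p X h = J-cong r (λ a b eq → overwrite-≤ {t} {p} {X} {a} {b} (≤-trans (≤-trans (m≤n+m b a) (≤-reflexive eq)) h))

    -- Overwriting removes the changes beyond `t` and may create one at the boundary. By the
    -- triangle inequality that one is charged to the removed changes and to the mismatch between
    -- `p` and the old end colour.
    J-overwrite : ∀ r t p (X : Path {K}) → J r (overwrite t p X) ≤ J r X + gt (suc r) t * d (X 0 (suc r)) p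
    J-overwrite r t p X with <-≤-connex t (suc r)
    ... | inj₂ h = ≤-trans (≤-reflexive (overwrite-none r t p X h)) (m≤m+n _ _)
    J-overwrite zero t p X | inj₁ h
      rewrite overwrite-> {p = p} {X} {0} h | overwrite-≤ {t} {p} {X} {1} {0} z≤n | gt-yes h | +-identityʳ (d (X 0 1) p) =
      d-triangle _ _ _
    J-overwrite (suc r) t p X | inj₁ h
      rewrite overwrite-> {p = p} {X} {0} h | gt-yes h | +-identityʳ (d (X 0 (suc (suc r))) p) with <-≤-connex t (suc r)
    ... | inj₂ h′
      rewrite overwrite-≤ {t} {p} {X} {1} {suc r} h′ | overwrite-none r t p (λ a b → X (suc a) b) h′ =
      ≤-trans (+-monoˡ-≤ _ (d-triangle (X 1 (suc r)) (X 0 (suc (suc r))) p))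
        (≤-reflexive (lem (d (X 1 (suc r)) (X 0 (suc (suc r)))) _ _))
      where
      lem : ∀ x y z → x + y + z ≡ x + z + y
      lem = solve-∀
    ... | inj₁ h′ rewrite overwrite-> {p = p} {X} {1} h′ | d-refl p = begin
      J r (overwrite t p (λ a b → X (suc a) b))
        ≤⟨ J-overwrite r t p (λ a b → X (suc a) b) ⟩
      Y + gt (suc r) t * d (X 1 (suc r)) p
        ≡⟨ trans (cong (λ g → Y + g * d (X 1 (suc r)) p) (gt-yes h′)) (cong (Y +_) (*-identityˡ _)) ⟩
      Y + d (X 1 (suc r)) p
        ≤⟨ +-monoʳ-≤ Y (d-triangle (X 1 (suc r)) (X 0 (suc (suc r))) p) ⟩
      Y + (d (X 1 (suc r)) (X 0 (suc (suc r))) + d (X 0 (suc (suc r))) p)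
        ≡⟨ lem Y (d (X 1 (suc r)) (X 0 (suc (suc r)))) (d (X 0 (suc (suc r))) p) ⟩
      d (X 1 (suc r)) (X 0 (suc (suc r))) + Y + d (X 0 (suc (suc r))) p ∎
      where
      open ≤-Reasoning
      Y : ℕ
      Y = J r (λ a b → X (suc a) b)
      lem : ∀ x y z → x + (y + z) ≡ y + x + z
      lem = solve-∀

    J-overwriteˡ : ∀ r t p (X : Path {K}) →
      J r (flip (overwrite t p (flip X))) ≤ J r X + gt (suc r) t * d (X (suc r) 0) p
    J-overwriteˡ r t p X = subst₂ (λ x y → x ≤ y + gt (suc r) t * d (X (suc r) 0) p)
      (J-flip r (overwrite t p (flip X))) (sym (J-flip r X)) (J-overwrite r t p (flip X))

    -- This dictates the side weights. The mismatch of a point with `p` is at most the number of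
    -- changes between it and the end, plus the mismatch at the end; the edge from `c` to `suc c` is
    -- charged by the points at positions above `t` up to `c`, that is `c ∸ t` times.
    ends-paid : ∀ m t p (X : Path {K}) → A (suc m) (λ b c → gt c t * d (X b c) p) ≤
      A m (λ b c → (c ∸ t) * d (X (suc b) c) (X b (suc c))) + (suc m ∸ t) * d (X 0 (suc m)) p
    ends-paid zero t p X = ≤-trans (≤-reflexive (+-identityʳ _))
      (≤-trans (*-monoˡ-≤ (d (X 0 1) p) (≤-trans (m≤m+n (gt 1 t) (0 ∸ t)) (≤-reflexive (gt-∸ 0 t)))) (m≤n+m _ _))
    ends-paid (suc m) t p X = begin
      g * D₀ + A (suc m) (λ b c → gt c t * d (X (suc b) c) p)
        ≤⟨ +-monoʳ-≤ (g * D₀) (ends-paid m t p (λ b c → X (suc b) c)) ⟩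
      g * D₀ + (Y + w * d (X 1 (suc m)) p)
        ≤⟨ +-monoʳ-≤ (g * D₀) (+-monoʳ-≤ Y (*-monoʳ-≤ w (d-triangle (X 1 (suc m)) (X 0 (suc (suc m))) p))) ⟩
      g * D₀ + (Y + w * (E + D₀))
        ≡⟨ lem g D₀ Y w E ⟩
      w * E + Y + (g + w) * D₀
        ≡⟨ cong (λ z → w * E + Y + z * D₀) (gt-∸ (suc m) t) ⟩
      w * E + Y + (suc (suc m) ∸ t) * D₀ ∎
      where
      open ≤-Reasoning
      g w D₀ E Y : ℕ
      g = gt (suc (suc m)) t
      w = suc m ∸ t
      D₀ = d (X 0 (suc (suc m))) p
      E = d (X 1 (suc m)) (X 0 (suc (suc m)))
      Y = A m (λ b c → (c ∸ t) * d (X (suc (suc b)) c) (X (suc b) (suc c)))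
      lem : ∀ g D Y w E → g * D + (Y + w * (E + D)) ≡ w * E + Y + (g + w) * D
      lem = solve-∀

    -- The mismatches that `J-overwrite` leaves unpaid, one for each row with an end beyond `t`,
    -- collected along the side where these rows end.
    end₂ end₃ : ℕ → ℕ → Colouring {K} → Fin K → ℕ
    end₂ m t X p = A m (λ a r → gt (suc r) t * d (X a (suc r) 0) p)
    end₃ m t X p = A m (λ a r → gt (suc r) t * d (X a 0 (suc r)) p)

    inner side weighted : ℕ → ℕ → Colouring {K} → ℕ
    inner m t X = S m (λ a b c → le a t * d (X a (suc b) c) (X a b (suc c)))
    side m t X = A m (λ b c → ((b ∸ t) + (c ∸ t)) * d (X 0 (suc b) c) (X 0 b (suc c)))
    weighted m t X = inner m t X + side m t X

    -- The rows of the two rotated directions end on the side `a = 0`. Near either vertex of this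
    -- side, `ends-paid` is applied with the colour of that vertex, so its remainder vanishes.
    side-pays : ∀ m t X p₂ p₃ → X 0 (suc m) 0 ≡ p₂ → X 0 0 (suc m) ≡ p₃ →
      end₂ m t (rot (rot X)) p₃ + end₃ m t (rot X) p₂ ≤ side m t X
    side-pays m t X p₂ p₃ refl refl = begin
      end₂ m t (rot (rot X)) p₃ + end₃ m t (rot X) p₂
        ≤⟨ +-mono-≤ (pay (X 0)) (pay (flip (X 0))) ⟩
      A m (λ b c → (c ∸ t) * d (X 0 (suc b) c) (X 0 b (suc c))) +
        A m (λ b c → (c ∸ t) * d (X 0 c (suc b)) (X 0 (suc c) b))
        ≡⟨ cong₂ _+_ refl (trans (A-swap m _) (A-cong m (λ b c _ → cong ((b ∸ t) *_) (d-sym _ _)))) ⟩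
      A m (λ b c → (c ∸ t) * d (X 0 (suc b) c) (X 0 b (suc c))) +
        A m (λ b c → (b ∸ t) * d (X 0 (suc b) c) (X 0 b (suc c)))
        ≡⟨ A-+ m _ _ ⟨
      A m (λ b c → (c ∸ t) * d (X 0 (suc b) c) (X 0 b (suc c)) + (b ∸ t) * d (X 0 (suc b) c) (X 0 b (suc c)))
        ≡⟨ A-cong m (λ b c _ → lem (c ∸ t) (b ∸ t) _) ⟩
      side m t X ∎
      where
      open ≤-Reasoning
      lem : ∀ x y z → x * z + y * z ≡ (y + x) * z
      lem = solve-∀
      pay : ∀ (Y : Path {K}) → A m (λ a r → gt (suc r) t * d (Y a (suc r)) (Y 0 (suc m))) ≤
        A m (λ b c → (c ∸ t) * d (Y (suc b) c) (Y b (suc c)))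
      pay Y = begin
        A m (λ a r → gt (suc r) t * d (Y a (suc r)) (Y 0 (suc m)))
          ≤⟨ m≤m+n _ _ ⟩
        _ ≡⟨ A-last m (λ b c → gt c t * d (Y b c) (Y 0 (suc m))) ⟨
        A (suc m) (λ b c → gt c t * d (Y b c) (Y 0 (suc m)))
          ≤⟨ ends-paid m t (Y 0 (suc m)) Y ⟩
        A m (λ b c → (c ∸ t) * d (Y (suc b) c) (Y b (suc c))) + (suc m ∸ t) * d (Y 0 (suc m)) (Y 0 (suc m))
          ≡⟨ cong (λ z → Z + (suc m ∸ t) * z) (d-refl (Y 0 (suc m))) ⟩
        Z + (suc m ∸ t) * 0
          ≡⟨ trans (cong (Z +_) (*-zeroʳ (suc m ∸ t))) (+-identityʳ Z) ⟩
        Z ∎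
        where
        Z : ℕ
        Z = A m (λ b c → (c ∸ t) * d (Y (suc b) c) (Y b (suc c)))

    J≤ : ∀ {L} (τ : Fin K → Fin L) r (X : Path {K}) → J r (λ a b → τ (X a b)) ≤ J r X
    J≤ τ r X = A-mono r (λ a b _ → d-map τ _ _)

  J-constant : ∀ {K} r (X : Path {K}) p → (∀ a b → a + b ≡ suc r → X a b ≡ p) → J r X ≡ 0
  J-constant r X p h = trans (A-cong r (λ a b eq → trans
    (cong₂ d (h (suc a) b (cong suc eq)) (h a (suc b) (trans (+-suc a b) (cong suc eq)))) (d-refl p))) (A-zero r)

  -- `R` is `X` seen through the colour map `τ`, with monochromatic corners. Stating this by
  -- properties makes it stable under rotation.
  record Fill {K L : ℕ} (n t : ℕ) (τ : Fin K → Fin L) (v₁ v₂ v₃ : Fin L) (X : Colouring {K}) (R : Colouring {L}) : Set where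
    field
      corner₁ : ∀ a b c → a + (b + c) ≡ n → t < a → R a b c ≡ v₁
      corner₂ : ∀ a b c → a + (b + c) ≡ n → t < b → R a b c ≡ v₂
      corner₃ : ∀ a b c → a + (b + c) ≡ n → t < c → R a b c ≡ v₃
      middle : ∀ a b c → a + (b + c) ≡ n → a ≤ t → b ≤ t → c ≤ t → R a b c ≡ τ (X a b c)

  rot-Fill : ∀ {K L n t} {τ : Fin K → Fin L} {v₁ v₂ v₃ X R} → Fill n t τ v₁ v₂ v₃ X R → Fill n t τ v₃ v₁ v₂ (rot X) (rot R)
  rot-Fill G = record
    { corner₁ = λ x y z eq → corner₃ y z x (rot-sum x y z eq)
    ; corner₂ = λ x y z eq → corner₁ y z x (rot-sum x y z eq)
    ; corner₃ = λ x y z eq → corner₂ y z x (rot-sum x y z eq)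
    ; middle = λ x y z eq hx hy hz → middle y z x (rot-sum x y z eq) hy hz hx
    }
    where open Fill G

  -- Rows inside the first corner become constant, which is why their edges carry no weight. Every
  -- other row is overwritten at both ends; recolouring by `τ` adds at most `o₂` or `o₃` to a
  -- mismatch, and `q` rows reach into each of the two corners.
  fam-fill : ∀ {K L} m q t → suc m ∸ t ≡ q → (τ : Fin K → Fin L) (v₁ v₂ v₃ : Fin L) (X : Colouring) (R : Colouring) →
    Fill (suc m) t τ v₁ v₂ v₃ X R → (u₂ u₃ : Fin K) (o₂ o₃ : ℕ) →
    (∀ x → d (τ x) v₂ ≤ d x u₂ + o₂) → (∀ x → d (τ x) v₃ ≤ d x u₃ + o₃) →
    Fam m R ≤ inner m t X + (end₂ m t X u₂ + end₃ m t X u₃) + q * (o₂ + o₃)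
  fam-fill {K} {L} m q t mt τ v₁ v₂ v₃ X R G u₂ u₃ o₂ o₃ h₂ h₃ = begin
    A m (λ a r → J r (R a))
      ≤⟨ A-mono m row ⟩
    A m (λ a r → I a r + (E₂ a r + E₃ a r) + (o₂ + o₃) * gt (suc r) t)
      ≡⟨ A-+ m (λ a r → I a r + (E₂ a r + E₃ a r)) (λ a r → (o₂ + o₃) * gt (suc r) t) ⟩
    A m (λ a r → I a r + (E₂ a r + E₃ a r)) + A m (λ a r → (o₂ + o₃) * gt (suc r) t)
      ≡⟨ cong₂ _+_ (trans (A-+ m I (λ a r → E₂ a r + E₃ a r)) (cong₂ _+_ inner-rows (A-+ m E₂ E₃)))
           (trans (A-* m (o₂ + o₃) _) (trans (cong ((o₂ + o₃) *_) (trans (A-gt m t) mt)) (*-comm (o₂ + o₃) q))) ⟩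
    inner m t X + (end₂ m t X u₂ + end₃ m t X u₃) + q * (o₂ + o₃) ∎
    where
    open ≤-Reasoning
    open Fill G
    I E₂ E₃ : ℕ → ℕ → ℕ
    I a r = le a t * J r (X a)
    E₂ a r = gt (suc r) t * d (X a (suc r) 0) u₂
    E₃ a r = gt (suc r) t * d (X a 0 (suc r)) u₃
    inner-rows : A m I ≡ inner m t X
    inner-rows = A-cong m (λ a r _ → sym (A-* r (le a t) _))
    row : ∀ a r → a + r ≡ m → J r (R a) ≤ I a r + (E₂ a r + E₃ a r) + (o₂ + o₃) * gt (suc r) t
    row a r eq with <-≤-connex t a
    ... | inj₁ lt = ≤-trans (≤-reflexive (J-constant r (R a) v₁ (λ b c e → corner₁ a b c (dom e) lt))) z≤n
      where
      dom : ∀ {s} → s ≡ suc r → a + s ≡ suc m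
      dom refl = trans (+-suc a r) (cong suc eq)
    ... | inj₂ ge = begin
      J r (R a)
        ≡⟨ J-cong r agree ⟩
      J r (flip (overwrite t v₂ (flip Z)))
        ≤⟨ J-overwriteˡ r t v₂ Z ⟩
      J r Z + g * d (Z (suc r) 0) v₂
        ≤⟨ +-monoˡ-≤ _ (J-overwrite r t v₃ τX) ⟩
      J r τX + g * d (τX 0 (suc r)) v₃ + g * d (τX (suc r) 0) v₂
        ≤⟨ +-mono-≤ (+-mono-≤ (J≤ τ r (X a)) (*-monoʳ-≤ g (h₃ (X a 0 (suc r))))) (*-monoʳ-≤ g (h₂ (X a (suc r) 0))) ⟩
      J r (X a) + g * (d (X a 0 (suc r)) u₃ + o₃) + g * (d (X a (suc r) 0) u₂ + o₂)
        ≡⟨ lem (J r (X a)) g _ o₃ _ o₂ ⟩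
      1 * J r (X a) + (E₂ a r + E₃ a r) + (o₂ + o₃) * g
        ≡⟨ cong (λ z → z * J r (X a) + (E₂ a r + E₃ a r) + (o₂ + o₃) * g) (le-yes ge) ⟨
      I a r + (E₂ a r + E₃ a r) + (o₂ + o₃) * g ∎
      where
      τX Z : Path {L}
      τX b c = τ (X a b c)
      Z = overwrite t v₃ τX
      g : ℕ
      g = gt (suc r) t
      lem : ∀ j g x o₃ y o₂ → j + g * (x + o₃) + g * (y + o₂) ≡ 1 * j + (g * y + g * x) + (o₂ + o₃) * g
      lem = solve-∀
      agree : ∀ b c → b + c ≡ suc r → R a b c ≡ flip (overwrite t v₂ (flip Z)) b c
      agree b c e with <-≤-connex t b | <-≤-connex t c | trans (cong (a +_) e) (trans (+-suc a r) (cong suc eq))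
      ... | inj₁ lt | _ | dm = trans (corner₂ a b c dm lt) (sym (overwrite-> {X = flip Z} lt))
      ... | inj₂ le′ | inj₁ lt | dm = trans (corner₃ a b c dm lt)
        (sym (trans (overwrite-≤ {X = flip Z} le′) (overwrite-> {X = τX} lt)))
      ... | inj₂ le′ | inj₂ le″ | dm = trans (middle a b c dm ge le′ le″)
        (sym (trans (overwrite-≤ {X = flip Z} le′) (overwrite-≤ {X = τX} le″)))

  -- The numbers `oᵢ`, `oⱼ`, `oₗ` flag the colours found opposite to their own vertex. A flag costs
  -- 2q because rows of two directions end in that corner, q of each.
  triangle-cost : ∀ {k} q m → suc (suc m) ≡ q + q + q → (X : Colouring {k}) (i j l : Fin k) → i ≢ j → j ≢ l → i ≢ l →
    X (suc (suc m)) 0 0 ≡ i → X 0 (suc (suc m)) 0 ≡ j → X 0 0 (suc (suc m)) ≡ l → (oᵢ oⱼ oₗ : ℕ) →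
    (∀ b c → b + c ≡ suc (suc m) → X 0 b c ≡ i → 0 < oᵢ) →
    (∀ c a → c + a ≡ suc (suc m) → X a 0 c ≡ j → 0 < oⱼ) →
    (∀ a b → a + b ≡ suc (suc m) → X a b 0 ≡ l → 0 < oₗ) →
    let W = weighted (suc m) (q + q) in
    2 * (q + q + q) ≤ W X + W (rot X) + W (rot (rot X)) + 2 * q * (oᵢ + oⱼ + oₗ)
  triangle-cost {k} q m mq X i j l i≢j j≢l i≢l X₁ X₂ X₃ oᵢ oⱼ oₗ fᵢ fⱼ fₗ = begin
    2 * (q + q + q)
      ≤⟨ good-cost q m mq (suc i) (suc j) (suc l) zero
           (distinct (i≢j ∘ Fin-suc-injective) (j≢l ∘ Fin-suc-injective) (i≢l ∘ Fin-suc-injective) (λ ()) (λ ()) (λ ())) R good ⟩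
    Fam M R + Fam M (rot R) + Fam M (rot (rot R))
      ≤⟨ +-mono-≤ (+-mono-≤
           (fam-fill M q t Mt τ (suc i) (suc j) (suc l) X R fill j l oⱼ oₗ τⱼ τₗ)
           (fam-fill M q t Mt τ (suc l) (suc i) (suc j) (rot X) (rot R) (rot-Fill fill) i j oᵢ oⱼ τᵢ τⱼ))
           (fam-fill M q t Mt τ (suc j) (suc l) (suc i) (rot (rot X)) (rot (rot R)) (rot-Fill (rot-Fill fill)) l i oₗ oᵢ τₗ τᵢ) ⟩
    _ ≡⟨ regroup (inner M t X) (inner M t (rot X)) (inner M t (rot (rot X)))
           (end₂ M t X j) (end₃ M t X l) (end₂ M t (rot X) i) (end₃ M t (rot X) j)
           (end₂ M t (rot (rot X)) l) (end₃ M t (rot (rot X)) i) q oᵢ oⱼ oₗ ⟩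
    _ ≤⟨ +-monoˡ-≤ (2 * q * (oᵢ + oⱼ + oₗ)) (+-mono-≤ (+-mono-≤
           (+-monoʳ-≤ (inner M t X) (side-pays M t X j l X₂ X₃))
           (+-monoʳ-≤ (inner M t (rot X)) (side-pays M t (rot X) i j X₁ X₂)))
           (+-monoʳ-≤ (inner M t (rot (rot X))) (side-pays M t (rot (rot X)) l i X₃ X₁))) ⟩
    weighted M t X + weighted M t (rot X) + weighted M t (rot (rot X)) + 2 * q * (oᵢ + oⱼ + oₗ) ∎
    where
    open ≤-Reasoning
    M n t : ℕ
    M = suc m
    n = suc M
    t = q + q
    Mt : suc M ∸ t ≡ q
    Mt = trans (cong (_∸ t) mq) (m+n∸m≡n t q)
    regroup : ∀ i₁ i₂ i₃ a₂ a₃ b₂ b₃ c₂ c₃ q x y z →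
      i₁ + (a₂ + a₃) + q * (y + z) + (i₂ + (b₂ + b₃) + q * (x + y)) + (i₃ + (c₂ + c₃) + q * (z + x))
      ≡ i₁ + (c₂ + b₃) + (i₂ + (a₂ + c₃)) + (i₃ + (b₂ + a₃)) + 2 * q * (x + y + z)
    regroup = solve-∀
    -- `zero` is the extra colour. It receives every colour other than `i`, `j`, `l`, and each of
    -- these whose flag is positive; the corners keep their own colours.
    pick : ℕ → Fin k → Fin (suc k)
    pick zero u = suc u
    pick (suc _) u = zero
    τ : Fin k → Fin (suc k)
    τ x with x ≟ i | x ≟ j | x ≟ l
    ... | yes _ | _ | _ = pick oᵢ i
    ... | no _ | yes _ | _ = pick oⱼ j
    ... | no _ | no _ | yes _ = pick oₗ l
    ... | no _ | no _ | no _ = zero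
    d-pick : ∀ o x u → x ≡ u → d (pick o u) (suc u) ≤ d x u + o
    d-pick zero x u refl = ≤-trans (≤-reflexive (d-refl (suc u))) z≤n
    d-pick (suc o) x u eq = ≤-trans (d≤1 _ _) (≤-trans (s≤s z≤n) (m≤n+m (suc o) _))
    d-other : ∀ {x u o} {v : Fin (suc k)} → x ≢ u → d v (suc u) ≤ d x u + o
    d-other {o = o} ne = ≤-trans (d≤1 _ _) (≤-trans (≤-reflexive (sym (d-≢ ne))) (m≤m+n _ o))
    τᵢ : ∀ x → d (τ x) (suc i) ≤ d x i + oᵢ
    τᵢ x with x ≟ i | x ≟ j | x ≟ l
    ... | yes p | _ | _ = d-pick oᵢ x i p
    ... | no p | yes _ | _ = d-other p
    ... | no p | no _ | yes _ = d-other p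
    ... | no p | no _ | no _ = d-other p
    τⱼ : ∀ x → d (τ x) (suc j) ≤ d x j + oⱼ
    τⱼ x with x ≟ i | x ≟ j | x ≟ l
    ... | yes p | _ | _ = d-other (λ r → i≢j (trans (sym p) r))
    ... | no _ | yes p | _ = d-pick oⱼ x j p
    ... | no _ | no p | yes _ = d-other p
    ... | no _ | no p | no _ = d-other p
    τₗ : ∀ x → d (τ x) (suc l) ≤ d x l + oₗ
    τₗ x with x ≟ i | x ≟ j | x ≟ l
    ... | yes p | _ | _ = d-other (λ r → i≢l (trans (sym p) r))
    ... | no _ | yes p | _ = d-other (λ r → j≢l (trans (sym p) r))
    ... | no _ | no _ | yes p = d-pick oₗ x l p
    ... | no _ | no _ | no p = d-other p
    R : Colouring
    R a b c with t <? a | t <? b | t <? c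
    ... | yes _ | _ | _ = suc i
    ... | no _ | yes _ | _ = suc j
    ... | no _ | no _ | yes _ = suc l
    ... | no _ | no _ | no _ = τ (X a b c)
    -- Corners are disjoint because 2q + 2q is at least n, so the order of the tests in `R` does not
    -- matter.
    exclusive : ∀ {x y} → x + y ≤ n → t < x → t < y → ⊥
    exclusive {x} {y} le′ lx ly = <⇒≱ {n} {suc t + t} (s≤s (≤-trans (≤-reflexive mq) (+-monoʳ-≤ t (m≤m+n q q))))
      (≤-trans (+-mono-≤ lx (<⇒≤ ly)) le′)
    ab≤ : ∀ a b c → a + (b + c) ≡ n → a + b ≤ n
    ab≤ a b c eq = ≤-trans (+-monoʳ-≤ a (m≤m+n b c)) (≤-reflexive eq)
    ac≤ : ∀ a b c → a + (b + c) ≡ n → a + c ≤ n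
    ac≤ a b c eq = ≤-trans (+-monoʳ-≤ a (m≤n+m c b)) (≤-reflexive eq)
    bc≤ : ∀ a b c → a + (b + c) ≡ n → b + c ≤ n
    bc≤ a b c eq = ≤-trans (m≤n+m _ a) (≤-reflexive eq)
    fill : Fill n t τ (suc i) (suc j) (suc l) X R
    fill = record { corner₁ = c₁ ; corner₂ = c₂ ; corner₃ = c₃ ; middle = mid }
      where
      c₁ : ∀ a b c → a + (b + c) ≡ n → t < a → R a b c ≡ suc i
      c₁ a b c eq lt with t <? a | t <? b | t <? c
      ... | yes _ | _ | _ = refl
      ... | no ¬p | _ | _ = ⊥-elim (¬p lt)
      c₂ : ∀ a b c → a + (b + c) ≡ n → t < b → R a b c ≡ suc j
      c₂ a b c eq lt with t <? a | t <? b | t <? c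
      ... | yes p | _ | _ = ⊥-elim (exclusive (ab≤ a b c eq) p lt)
      ... | no _ | yes _ | _ = refl
      ... | no _ | no ¬p | _ = ⊥-elim (¬p lt)
      c₃ : ∀ a b c → a + (b + c) ≡ n → t < c → R a b c ≡ suc l
      c₃ a b c eq lt with t <? a | t <? b | t <? c
      ... | yes p | _ | _ = ⊥-elim (exclusive (ac≤ a b c eq) p lt)
      ... | no _ | yes p | _ = ⊥-elim (exclusive (bc≤ a b c eq) p lt)
      ... | no _ | no _ | yes _ = refl
      ... | no _ | no _ | no ¬p = ⊥-elim (¬p lt)
      mid : ∀ a b c → a + (b + c) ≡ n → a ≤ t → b ≤ t → c ≤ t → R a b c ≡ τ (X a b c)
      mid a b c eq ha hb hc with t <? a | t <? b | t <? c
      ... | yes p | _ | _ = ⊥-elim (<⇒≱ p ha)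
      ... | no _ | yes p | _ = ⊥-elim (<⇒≱ p hb)
      ... | no _ | no _ | yes p = ⊥-elim (<⇒≱ p hc)
      ... | no _ | no _ | no _ = refl
    good : Good n t zero (suc i) (suc j) (suc l) R
    good = record { corner₁ = Fill.corner₁ fill ; corner₂ = Fill.corner₂ fill ; corner₃ = Fill.corner₃ fill ; valid = valid }
      where
      Valid : Fin (suc k) → ℕ → ℕ → ℕ → Set
      Valid v a b c = ((v ≡ suc i × 0 < a) ⊎ (v ≡ suc j × 0 < b) ⊎ (v ≡ suc l × 0 < c)) ⊎ v ≡ zero
      pick≡ : ∀ o u → pick o u ≡ zero ⊎ (o ≡ 0 × pick o u ≡ suc u)
      pick≡ zero u = inj₂ (refl , refl)
      pick≡ (suc o) u = inj₁ refl
      -- A colour survives `τ` only if its flag is zero, and then the hypothesis on that flag keeps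
      -- it off the side opposite to its vertex.
      τ-valid : ∀ a b c → a + (b + c) ≡ n → Valid (τ (X a b c)) a b c
      τ-valid a b c eq with X a b c ≟ i | X a b c ≟ j | X a b c ≟ l
      ... | no _ | no _ | no _ = inj₂ refl
      ... | yes p | _ | _ with pick≡ oᵢ i
      ...   | inj₁ z = inj₂ z
      ...   | inj₂ (o≡0 , s) = inj₁ (inj₁ (s , n≢0⇒n>0 λ { refl → n≮0 (subst (0 <_) o≡0 (fᵢ b c eq p)) }))
      τ-valid a b c eq | no _ | yes p | _ with pick≡ oⱼ j
      ...   | inj₁ z = inj₂ z
      ...   | inj₂ (o≡0 , s) = inj₁ (inj₂ (inj₁ (s , n≢0⇒n>0 λ { refl →
        n≮0 (subst (0 <_) o≡0 (fⱼ c a (trans (+-comm c a) eq) p)) })))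
      τ-valid a b c eq | no _ | no _ | yes p with pick≡ oₗ l
      ...   | inj₁ z = inj₂ z
      ...   | inj₂ (o≡0 , s) = inj₁ (inj₂ (inj₂ (s , n≢0⇒n>0 λ { refl →
        n≮0 (subst (0 <_) o≡0 (fₗ a b (trans (cong (a +_) (sym (+-identityʳ b))) eq) p)) })))
      valid : ∀ a b c → a + (b + c) ≡ n → Valid (R a b c) a b c
      valid a b c eq with t <? a | t <? b | t <? c
      ... | yes p | _ | _ = inj₁ (inj₁ (refl , ≤-trans (s≤s z≤n) p))
      ... | no _ | yes p | _ = inj₁ (inj₂ (inj₁ (refl , ≤-trans (s≤s z≤n) p)))
      ... | no _ | no _ | yes p = inj₁ (inj₂ (inj₂ (refl , ≤-trans (s≤s z≤n) p)))
      ... | no _ | no _ | no _ = τ-valid a b c eq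

  -- All triangles and segments together

  sumF : ∀ k → (Fin k → ℕ) → ℕ
  sumF zero f = 0
  sumF (suc k) f = f zero + sumF k (f ∘ suc)

  sumF-mono : ∀ k {f g : Fin k → ℕ} → (∀ x → f x ≤ g x) → sumF k f ≤ sumF k g
  sumF-mono zero h = z≤n
  sumF-mono (suc k) h = +-mono-≤ (h zero) (sumF-mono k (h ∘ suc))

  sumF-cong : ∀ k {f g : Fin k → ℕ} → (∀ x → f x ≡ g x) → sumF k f ≡ sumF k g
  sumF-cong zero h = refl
  sumF-cong (suc k) h = cong₂ _+_ (h zero) (sumF-cong k (h ∘ suc))

  sumF-zero : ∀ k → sumF k (λ _ → 0) ≡ 0
  sumF-zero zero = refl
  sumF-zero (suc k) = sumF-zero k

  sumF-one : ∀ k → sumF k (λ _ → 1) ≡ k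
  sumF-one zero = refl
  sumF-one (suc k) = cong suc (sumF-one k)

  sumF-+ : ∀ k f g → sumF k (λ x → f x + g x) ≡ sumF k f + sumF k g
  sumF-+ zero f g = refl
  sumF-+ (suc k) f g = trans (cong (f zero + g zero +_) (sumF-+ k (f ∘ suc) (g ∘ suc)))
    (lem (f zero) (g zero) (sumF k (f ∘ suc)) (sumF k (g ∘ suc)))
    where
    lem : ∀ x y z t → x + y + (z + t) ≡ x + z + (y + t)
    lem = solve-∀

  sumF-* : ∀ k c f → sumF k (λ x → c * f x) ≡ c * sumF k f
  sumF-* zero c f = sym (*-zeroʳ c)
  sumF-* (suc k) c f = trans (cong (c * f zero +_) (sumF-* k c (f ∘ suc))) (sym (*-distribˡ-+ c (f zero) _))

  sumF-swap : ∀ k l (f : Fin k → Fin l → ℕ) → sumF k (λ x → sumF l (f x)) ≡ sumF l (λ y → sumF k (λ x → f x y))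
  sumF-swap zero l f = sym (sumF-zero l)
  sumF-swap (suc k) l f = trans (cong (sumF l (f zero) +_) (sumF-swap k l (f ∘ suc))) (sym (sumF-+ l (f zero) _))

  e-suc : ∀ {k} (x y : Fin k) → e (suc x) (suc y) ≡ e x y
  e-suc x y with x ≟ y
  ... | yes refl = trans (e-refl (suc x)) (sym (e-refl x))
  ... | no ne = trans (e-≢ (λ { refl → ne refl })) (sym (e-≢ ne))

  e-sym : ∀ {k} (x y : Fin k) → e x y ≡ e y x
  e-sym x y with x ≟ y
  ... | yes refl = refl
  ... | no ne = trans (e-≢ ne) (sym (e-≢ (ne ∘ sym)))

  e+d : ∀ {k} (x y : Fin k) → e x y + d x y ≡ 1
  e+d x y with x ≟ y
  ... | yes refl = cong₂ _+_ (e-refl x) (d-refl x)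
  ... | no ne = cong₂ _+_ (e-≢ ne) (d-≢ ne)

  sumF-e : ∀ {k} (x : Fin k) → sumF k (e x) ≡ 1
  sumF-e {suc k} zero = cong₂ _+_ (e-refl zero) (trans (sumF-cong k (λ y → e-≢ (λ ()))) (sumF-zero k))
  sumF-e {suc k} (suc x) = cong₂ _+_ (e-≢ (λ ())) (trans (sumF-cong k (λ y → e-suc x y)) (sumF-e x))

  sum³ : ∀ k → (Fin k → Fin k → Fin k → ℕ) → ℕ
  sum³ k f = sumF k (λ i → sumF k (λ j → sumF k (f i j)))

  sum² : ∀ k → (Fin k → Fin k → ℕ) → ℕ
  sum² k f = sumF k (λ i → sumF k (f i))

  sum³-mono : ∀ k {f g : Fin k → Fin k → Fin k → ℕ} → (∀ i j l → f i j l ≤ g i j l) → sum³ k f ≤ sum³ k g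
  sum³-mono k h = sumF-mono k (λ i → sumF-mono k (λ j → sumF-mono k (h i j)))

  sum³-cong : ∀ k {f g : Fin k → Fin k → Fin k → ℕ} → (∀ i j l → f i j l ≡ g i j l) → sum³ k f ≡ sum³ k g
  sum³-cong k h = sumF-cong k (λ i → sumF-cong k (λ j → sumF-cong k (h i j)))

  sum³-+ : ∀ k f g → sum³ k (λ i j l → f i j l + g i j l) ≡ sum³ k f + sum³ k g
  sum³-+ k f g = trans (sumF-cong k (λ i → trans (sumF-cong k (λ j → sumF-+ k (f i j) (g i j))) (sumF-+ k _ _))) (sumF-+ k _ _)

  sum³-* : ∀ k c f → sum³ k (λ i j l → c * f i j l) ≡ c * sum³ k f
  sum³-* k c f = trans (sumF-cong k (λ i → trans (sumF-cong k (λ j → sumF-* k c (f i j))) (sumF-* k c _))) (sumF-* k c _)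

  sum²-mono : ∀ k {f g : Fin k → Fin k → ℕ} → (∀ i j → f i j ≤ g i j) → sum² k f ≤ sum² k g
  sum²-mono k h = sumF-mono k (λ i → sumF-mono k (h i))

  sum²-+ : ∀ k f g → sum² k (λ i j → f i j + g i j) ≡ sum² k f + sum² k g
  sum²-+ k f g = trans (sumF-cong k (λ i → sumF-+ k (f i) (g i))) (sumF-+ k _ _)

  sum²-* : ∀ k c f → sum² k (λ i j → c * f i j) ≡ c * sum² k f
  sum²-* k c f = trans (sumF-cong k (λ i → sumF-* k c (f i))) (sumF-* k c _)

  sum³-rot : ∀ k f → sum³ k f ≡ sum³ k (λ i j l → f l i j)
  sum³-rot k f = trans (sumF-swap k k (λ i j → sumF k (f i j))) (sumF-cong k (λ j → sumF-swap k k (λ i → f i j)))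

  -- app r X l is positive when the colour l occurs among the points of the path with a + b ≡ r.
  app : ∀ {K} → ℕ → Path {K} → Fin K → ℕ
  app zero X l = e (X 0 0) l
  app (suc r) X l = e (X 0 (suc r)) l ⊔ app r (λ a b → X (suc a) b) l

  app-occurs : ∀ {K} r (X : Path {K}) a b → a + b ≡ r → 0 < app r X (X a b)
  app-occurs zero X zero zero refl = ≤-reflexive (sym (e-refl (X 0 0)))
  app-occurs (suc r) X zero b refl = ≤-trans (≤-reflexive (sym (e-refl (X 0 b)))) (m≤m⊔n _ _)
  app-occurs (suc r) X (suc a) b eq = ≤-trans (app-occurs r (λ a b → X (suc a) b) a b (suc-injective eq)) (m≤n⊔m (e (X 0 (suc r)) _) _)

  app-step : ∀ {K} r (X : Path {K}) l →
    app (suc r) X l ≤ d (X 1 r) (X 0 (suc r)) * e (X 0 (suc r)) l + app r (λ a b → X (suc a) b) l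
  app-step r X l with X 1 r ≟ X 0 (suc r)
  ... | no ne rewrite d-≢ ne | +-identityʳ (e (X 0 (suc r)) l) = m⊔n≤m+n (e (X 0 (suc r)) l) _
  ... | yes p rewrite d-≡ p = ⊔-lub (occurs (X 0 (suc r)) p) ≤-refl
    where
    occurs : ∀ x → X 1 r ≡ x → e x l ≤ app r (λ a b → X (suc a) b) l
    occurs x refl with x ≟ l
    ... | yes refl = ≤-trans (e≤1 x l) (app-occurs r (λ a b → X (suc a) b) 0 r refl)
    ... | no ne = ≤-trans (≤-reflexive (e-≢ ne)) z≤n

  -- The left side is the number of distinct colours. Walking along the path, a new colour can only
  -- appear at a change.
  app-count : ∀ {K} r (X : Path {K}) → sumF K (app (suc r) X) ≤ J r X + 1
  app-count {K} r X = ≤-trans (sumF-mono K (app-step r X))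
    (≤-trans (≤-reflexive (trans (sumF-+ K _ _) (cong (_+ sumF K (app r X′)) (trans (sumF-* K D _) (trans (cong (D *_) (sumF-e (X 0 (suc r)))) (*-identityʳ D))))))
      (rest r X))
    where
    X′ : Path {K}
    X′ a b = X (suc a) b
    D : ℕ
    D = d (X 1 r) (X 0 (suc r))
    rest : ∀ r (X : Path {K}) → d (X 1 r) (X 0 (suc r)) + sumF K (app r (λ a b → X (suc a) b)) ≤ J r X + 1
    rest zero X = +-monoʳ-≤ (d (X 1 0) (X 0 1)) (≤-reflexive (sumF-e (X 1 0)))
    rest (suc r) X = ≤-trans (+-monoʳ-≤ _ (app-count r (λ a b → X (suc a) b))) (≤-reflexive (sym (+-assoc _ (J r (λ a b → X (suc a) b)) 1)))

  -- The two end colours are among those counted by `app-count`; taking them out leaves one change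
  -- beyond the number of further colours. That change is what the segment contributes to the cut
  -- bound.
  app-others : ∀ {K} r (X : Path {K}) i j → i ≢ j → X (suc r) 0 ≡ i → X 0 (suc r) ≡ j →
    1 + sumF K (λ l → d j l * d l i * app (suc r) X l) ≤ J r X
  app-others {K} r X i j i≢j refl refl = +-cancelʳ-≤ 1 _ _ (begin
    1 + sumF K others + 1
      ≡⟨ lem (sumF K others) ⟩
    1 + 1 + sumF K others
      ≡⟨ cong₂ (λ x y → x + y + sumF K others) (sumF-e i) (sumF-e j) ⟨
    sumF K (e i) + sumF K (e j) + sumF K others
      ≡⟨ trans (sumF-+ K (λ l → e i l + e j l) others) (cong (_+ sumF K others) (sumF-+ K (e i) (e j))) ⟨
    sumF K (λ l → e i l + e j l + others l)
      ≤⟨ sumF-mono K pointwise ⟩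
    sumF K (app (suc r) X)
      ≤⟨ app-count r X ⟩
    J r X + 1 ∎)
    where
    open ≤-Reasoning
    others : Fin K → ℕ
    others l = d j l * d l i * app (suc r) X l
    lem : ∀ x → 1 + x + 1 ≡ 1 + 1 + x
    lem = solve-∀
    pointwise : ∀ l → e i l + e j l + others l ≤ app (suc r) X l
    pointwise l with i ≟ l | j ≟ l
    ... | yes refl | _ = ≤-trans (≤-reflexive (cong₂ _+_ (cong₂ _+_ (e-refl i) (e-≢ (i≢j ∘ sym)))
      (cong (_* app (suc r) X i) (trans (cong (d j i *_) (d-refl i)) (*-zeroʳ (d j i))))))
      (app-occurs (suc r) X (suc r) 0 (+-identityʳ _))
    ... | no ne | yes refl = ≤-trans (≤-reflexive (cong₂ _+_ (cong₂ _+_ (e-≢ ne) (e-refl j))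
      (cong (λ z → z * d j i * app (suc r) X j) (d-refl j))))
      (app-occurs (suc r) X 0 (suc r) refl)
    ... | no ne | no ne′ = ≤-reflexive (trans (cong₂ _+_ (cong₂ _+_ (e-≢ ne) (e-≢ ne′))
      (cong₂ (λ x y → x * y * app (suc r) X l) (d-≢ ne′) (d-≢ (ne ∘ sym)))) (+-identityʳ _))

  -- Points of triangles and segments, the weights and the cut bound

  module _ {k : ℕ} where

    pt : Fin k → Fin k → Fin k → ℕ → ℕ → ℕ → Vec ℕ k
    pt i j l a b c = tabulate (λ x → a * e x i + (b * e x j + c * e x l))

    ln : Fin k → Fin k → ℕ → ℕ → Vec ℕ k
    ln i j a b = tabulate (λ x → a * e x i + b * e x j)

    pt-rot : ∀ i j l x y z → pt i j l y z x ≡ pt l i j x y z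
    pt-rot i j l x y z = tabulate-cong (λ w → lem (y * e w i) (z * e w j) (x * e w l))
      where
      lem : ∀ p q r → p + (q + r) ≡ r + (p + q)
      lem = solve-∀

    pt-ln₂ : ∀ i j l a c → pt i j l a 0 c ≡ ln l i c a
    pt-ln₂ i j l a c = tabulate-cong (λ w → +-comm (a * e w i) (c * e w l))

    pt-ln₃ : ∀ i j l a b → pt i j l a b 0 ≡ ln i j a b
    pt-ln₃ i j l a b = tabulate-cong (λ w → cong (a * e w i +_) (+-identityʳ (b * e w j)))

    ln-vertex₁ : ∀ n i j → ln i j n 0 ≡ vertex n i
    ln-vertex₁ n i j = tabulate-cong (λ w → trans (+-identityʳ (n * e w i)) (val w))
      where
      val : ∀ w → n * e w i ≡ (if does (w ≟ i) then n else 0)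
      val w rewrite e-def w i with does (w ≟ i)
      ... | true = *-identityʳ n
      ... | false = *-zeroʳ n

    ln-vertex₂ : ∀ n i j → ln i j 0 n ≡ vertex n j
    ln-vertex₂ n i j = trans (sym (pt-ln₃′ n i j)) (ln-vertex₁ n j i)
      where
      pt-ln₃′ : ∀ n i j → ln j i n 0 ≡ ln i j 0 n
      pt-ln₃′ n i j = tabulate-cong (λ w → +-identityʳ (n * e w j))

    distinct₃ : Fin k → Fin k → Fin k → ℕ
    distinct₃ i j l = d i j * (d j l * d l i)

    distinct₃-rot : ∀ i j l → distinct₃ l i j ≡ distinct₃ i j l
    distinct₃-rot i j l = lem (d l i) (d i j) (d j l)
      where
      lem : ∀ x y z → x * (y * z) ≡ y * (z * x)
      lem = solve-∀

    distinct₃-cases : ∀ i j l → distinct₃ i j l ≡ 0 ⊎ (i ≢ j × j ≢ l × i ≢ l)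
    distinct₃-cases i j l with i ≟ j | j ≟ l | l ≟ i
    ... | yes p | _ | _ rewrite d-≡ p = inj₁ refl
    ... | no _ | yes p | _ rewrite d-≡ p = inj₁ (*-zeroʳ (d i j))
    ... | no _ | no _ | yes p rewrite d-≡ p | *-zeroʳ (d j l) = inj₁ (*-zeroʳ (d i j))
    ... | no p | no q | no r = inj₂ (p , q , r ∘ sym)

    module Weights (q m : ℕ) where

      M t : ℕ
      M = suc m
      t = q + q

      -- Within the triangle on e_i, e_j, e_l these are the edges parallel to the side jl (the other two
      -- directions come from the rotated triples), except those inside the corner at e_i; the extra
      -- weights on the side jl grow towards its ends so that every level cut of a corner costs 2q.
      triangle-sum : Fin k → Fin k → Fin k → (Vec ℕ k → Vec ℕ k → ℕ) → ℕ
      triangle-sum i j l h =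
        S M (λ a b c → le a t * h (pt i j l a (suc b) c) (pt i j l a b (suc c))) +
        A M (λ b c → ((b ∸ t) + (c ∸ t)) * h (pt i j l 0 (suc b) c) (pt i j l 0 b (suc c)))

      line-sum : Fin k → Fin k → (Vec ℕ k → Vec ℕ k → ℕ) → ℕ
      line-sum i j h = A M (λ a b → h (ln i j (suc a) b) (ln i j a (suc b)))

      -- Summing over ordered triples and pairs counts every direction of every triangle twice, and
      -- every segment twice. The factor `2 * q` is the price of one flag in `triangle-cost`.
      total : (Vec ℕ k → Vec ℕ k → ℕ) → ℕ
      total h = sum³ k (λ i j l → distinct₃ i j l * triangle-sum i j l h)
              + sum² k (λ i j → d i j * (2 * q * line-sum i j h))

      module CutBound (mq : suc (suc m) ≡ q + q + q) (P : Vec ℕ k → Fin k) (isCut : IsKWayCut k (suc M) P) where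

        cut : Vec ℕ k → Vec ℕ k → ℕ
        cut u v = d (P u) (P v)

        X : Fin k → Fin k → Fin k → Colouring
        X i j l a b c = P (pt i j l a b c)

        opp : Fin k → Fin k → Fin k → ℕ
        opp i j l = app (suc M) (λ a b → P (ln i j a b)) l

        weighted-cong : ∀ {Y Z : Colouring {k}} → (∀ a b c → Y a b c ≡ Z a b c) → weighted M t Y ≡ weighted M t Z
        weighted-cong h = cong₂ _+_
          (A-cong M (λ a r _ → A-cong r (λ b c _ → cong (le a t *_) (cong₂ d (h a (suc b) c) (h a b (suc c))))))
          (A-cong M (λ b c _ → cong (((b ∸ t) + (c ∸ t)) *_) (cong₂ d (h 0 (suc b) c) (h 0 b (suc c)))))

        T : Fin k → Fin k → Fin k → ℕ
        T i j l = triangle-sum i j l cut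

        triangle : ∀ i j l → i ≢ j → j ≢ l → i ≢ l →
          2 * (q + q + q) ≤ T i j l + T l i j + T j l i + 2 * q * (opp j l i + opp l i j + opp i j l)
        triangle i j l i≢j j≢l i≢l = ≤-trans
          (triangle-cost q m mq (X i j l) i j l i≢j j≢l i≢l
            (trans (cong P (trans (pt-ln₃ i j l (suc M) 0) (ln-vertex₁ (suc M) i j))) (isCut i))
            (trans (cong P (ln-vertex₁ (suc M) j l)) (isCut j))
            (trans (cong P (ln-vertex₂ (suc M) j l)) (isCut l))
            (opp j l i) (opp l i j) (opp i j l)
            (λ b c eq p → subst (λ z → 0 < opp j l z) p (app-occurs (suc M) (λ a b → P (ln j l a b)) b c eq))
            (λ c a eq p → subst (λ z → 0 < opp l i z) (trans (cong P (sym (pt-ln₂ i j l a c))) p) (app-occurs (suc M) (λ a b → P (ln l i a b)) c a eq))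
            (λ a b eq p → subst (λ z → 0 < opp i j z) (trans (cong P (sym (pt-ln₃ i j l a b))) p) (app-occurs (suc M) (λ a b → P (ln i j a b)) a b eq)))
          (≤-reflexive (cong (_+ 2 * q * (opp j l i + opp l i j + opp i j l)) (cong₂ _+_ (cong (T i j l +_)
            (weighted-cong (λ a b c → cong P (pt-rot i j l a b c))))
            (weighted-cong (λ a b c → cong P (trans (pt-rot i j l b c a) (pt-rot l i j a b c)))))))

        line : ∀ i j → i ≢ j → 1 + sumF k (λ l → d j l * d l i * opp i j l) ≤ line-sum i j cut
        line i j i≢j = app-others M (λ a b → P (ln i j a b)) i j i≢j
          (trans (cong P (ln-vertex₁ (suc M) i j)) (isCut i)) (trans (cong P (ln-vertex₂ (suc M) i j)) (isCut j))

        D O : Fin k → Fin k → Fin k → ℕ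
        D = distinct₃
        O i j l = D i j l * opp i j l

        -- Summed over all ordered triples, the three rotations in `triangle` yield equal totals;
        -- hence the factor 3 that is cancelled.
        triangles : 2 * q * sum³ k D ≤ sum³ k (λ i j l → D i j l * T i j l) + 2 * q * sum³ k O
        triangles = *-cancelˡ-≤ 3 (begin
          3 * (2 * q * sum³ k D)
            ≡⟨ trans (lem₁ q (sum³ k D)) (sym (sum³-* k (2 * (q + q + q)) D)) ⟩
          sum³ k (λ i j l → 2 * (q + q + q) * D i j l)
            ≤⟨ sum³-mono k pointwise ⟩
          sum³ k (λ i j l → DT i j l + DT l i j + DT j l i + 2 * q * (O j l i + O l i j + O i j l))
            ≡⟨ trans (sum³-+ k _ _) (cong₂ _+_ (three DT) (trans (sum³-* k (2 * q) _) (cong (2 * q *_) (three′ O)))) ⟩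
          sum³ k DT + sum³ k DT + sum³ k DT + 2 * q * (sum³ k O + sum³ k O + sum³ k O)
            ≡⟨ lem₂ q (sum³ k DT) (sum³ k O) ⟩
          3 * (sum³ k DT + 2 * q * sum³ k O) ∎)
          where
          open ≤-Reasoning
          DT : Fin k → Fin k → Fin k → ℕ
          DT i j l = D i j l * T i j l
          lem₁ : ∀ q s → 3 * (2 * q * s) ≡ 2 * (q + q + q) * s
          lem₁ = solve-∀
          lem₂ : ∀ q s o → s + s + s + 2 * q * (o + o + o) ≡ 3 * (s + 2 * q * o)
          lem₂ = solve-∀
          three : ∀ f → sum³ k (λ i j l → f i j l + f l i j + f j l i) ≡ sum³ k f + sum³ k f + sum³ k f
          three f = trans (sum³-+ k _ _) (cong₂ _+_ (trans (sum³-+ k f _) (cong (sum³ k f +_) (sym (sum³-rot k f))))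
            (sym (trans (sum³-rot k f) (sum³-rot k (λ i j l → f l i j)))))
          three′ : ∀ f → sum³ k (λ i j l → f j l i + f l i j + f i j l) ≡ sum³ k f + sum³ k f + sum³ k f
          three′ f = trans (sum³-cong k (λ i j l → lem₃ (f j l i) (f l i j) (f i j l))) (three f)
            where
            lem₃ : ∀ x y z → x + y + z ≡ z + y + x
            lem₃ = solve-∀
          expand : ∀ D x y z o₁ o₂ o₃ q → D * (x + y + z + 2 * q * (o₁ + o₂ + o₃)) ≡
            D * x + D * y + D * z + 2 * q * (D * o₁ + D * o₂ + D * o₃)
          expand = solve-∀
          pointwise : ∀ i j l → 2 * (q + q + q) * D i j l ≤ DT i j l + DT l i j + DT j l i + 2 * q * (O j l i + O l i j + O i j l)
          pointwise i j l with distinct₃-cases i j l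
          ... | inj₁ z = ≤-trans (≤-reflexive (trans (cong (2 * (q + q + q) *_) z) (*-zeroʳ (2 * (q + q + q))))) z≤n
          ... | inj₂ (i≢j , j≢l , i≢l) = begin
            2 * (q + q + q) * D i j l
              ≡⟨ *-comm (2 * (q + q + q)) (D i j l) ⟩
            D i j l * (2 * (q + q + q))
              ≤⟨ *-monoʳ-≤ (D i j l) (triangle i j l i≢j j≢l i≢l) ⟩
            D i j l * (T i j l + T l i j + T j l i + 2 * q * (opp j l i + opp l i j + opp i j l))
              ≡⟨ expand (D i j l) (T i j l) (T l i j) (T j l i) (opp j l i) (opp l i j) (opp i j l) q ⟩
            _ ≡⟨ cong₂ (λ x y → D i j l * T i j l + x * T l i j + y * T j l i + 2 * q * (y * opp j l i + x * opp l i j + D i j l * opp i j l))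
                   (sym (distinct₃-rot i j l)) (distinct₃-rot j l i) ⟩
            DT i j l + DT l i j + DT j l i + 2 * q * (O j l i + O l i j + O i j l) ∎

        -- Each flag `O i j l` belongs to exactly one ordered segment, the one from `i` to `j`, so
        -- summing `line` over the segments recovers all flags.
        lines : 2 * q * sum² k d + 2 * q * sum³ k O ≤ sum² k (λ i j → d i j * (2 * q * line-sum i j cut))
        lines = begin
          2 * q * sum² k d + 2 * q * sum³ k O
            ≡⟨ cong₂ _+_ (sum²-* k (2 * q) d) (sum²-* k (2 * q) (λ i j → sumF k (O i j))) ⟨
          sum² k (λ i j → 2 * q * d i j) + sum² k (λ i j → 2 * q * sumF k (O i j))
            ≡⟨ sum²-+ k _ _ ⟨
          sum² k (λ i j → 2 * q * d i j + 2 * q * sumF k (O i j))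
            ≤⟨ sum²-mono k pointwise ⟩
          sum² k (λ i j → d i j * (2 * q * line-sum i j cut)) ∎
          where
          open ≤-Reasoning
          regroup : ∀ d q s → 2 * q * d + 2 * q * (d * s) ≡ d * (2 * q * (1 + s))
          regroup = solve-∀
          assoc₄ : ∀ x y z w → x * (y * z) * w ≡ x * (y * z * w)
          assoc₄ = solve-∀
          pointwise : ∀ i j → 2 * q * d i j + 2 * q * sumF k (O i j) ≤ d i j * (2 * q * line-sum i j cut)
          pointwise i j = begin
            2 * q * d i j + 2 * q * sumF k (O i j)
              ≡⟨ cong (λ z → 2 * q * d i j + 2 * q * z) (trans (sumF-cong k (λ l → assoc₄ (d i j) (d j l) (d l i) (opp i j l))) (sumF-* k (d i j) _)) ⟩
            2 * q * d i j + 2 * q * (d i j * R)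
              ≡⟨ regroup (d i j) q R ⟩
            d i j * (2 * q * (1 + R))
              ≤⟨ step (i ≟ j) ⟩
            d i j * (2 * q * line-sum i j cut) ∎
            where
            R : ℕ
            R = sumF k (λ l → d j l * d l i * opp i j l)
            step : Dec (i ≡ j) → d i j * (2 * q * (1 + R)) ≤ d i j * (2 * q * line-sum i j cut)
            step (yes p) rewrite d-≡ p = z≤n
            step (no ne) = *-monoʳ-≤ (d i j) (*-monoʳ-≤ (2 * q) (line i j ne))

        -- The surplus of the segments equals the deficit of the triangles, `2 * q * sum³ k O`,
        -- whatever the cut is.
        cut-bound : 2 * q * (sum³ k distinct₃ + sum² k d) ≤ total cut
        cut-bound = +-cancelʳ-≤ (2 * q * sum³ k O) _ _ (begin
          2 * q * (sum³ k D + sum² k d) + 2 * q * sum³ k O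
            ≡⟨ lem₁ q (sum³ k D) (sum² k d) (sum³ k O) ⟩
          2 * q * sum³ k D + (2 * q * sum² k d + 2 * q * sum³ k O)
            ≤⟨ +-mono-≤ triangles lines ⟩
          sum³ k (λ i j l → D i j l * T i j l) + 2 * q * sum³ k O + sum² k (λ i j → d i j * (2 * q * line-sum i j cut))
            ≡⟨ lem₂ (sum³ k (λ i j l → D i j l * T i j l)) (2 * q * sum³ k O) _ ⟩
          total cut + 2 * q * sum³ k O ∎)
          where
          open ≤-Reasoning
          lem₁ : ∀ q x y z → 2 * q * (x + y) + 2 * q * z ≡ 2 * q * x + (2 * q * y + 2 * q * z)
          lem₁ = solve-∀
          lem₂ : ∀ x y z → x + y + z ≡ x + z + y
          lem₂ = solve-∀

  -- Edge multiplicities and total weight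

  sumL : {B : Set} → List B → (B → ℕ) → ℕ
  sumL [] f = 0
  sumL (x ∷ xs) f = f x + sumL xs f

  sumL-cong : ∀ {B : Set} xs {f g : B → ℕ} → (∀ x → f x ≡ g x) → sumL xs f ≡ sumL xs g
  sumL-cong [] h = refl
  sumL-cong (x ∷ xs) h = cong₂ _+_ (h x) (sumL-cong xs h)

  sumL-+ : ∀ {B : Set} xs (f g : B → ℕ) → sumL xs (λ x → f x + g x) ≡ sumL xs f + sumL xs g
  sumL-+ [] f g = refl
  sumL-+ (x ∷ xs) f g = trans (cong (f x + g x +_) (sumL-+ xs f g)) (lem (f x) (g x) (sumL xs f) (sumL xs g))
    where
    lem : ∀ x y z t → x + y + (z + t) ≡ x + z + (y + t)
    lem = solve-∀

  sumL-* : ∀ {B : Set} xs c (f : B → ℕ) → sumL xs (λ x → c * f x) ≡ c * sumL xs f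
  sumL-* [] c f = sym (*-zeroʳ c)
  sumL-* (x ∷ xs) c f = trans (cong (c * f x +_) (sumL-* xs c f)) (sym (*-distribˡ-+ c (f x) _))

  sumL-++ : ∀ {B : Set} xs ys (f : B → ℕ) → sumL (xs ++ ys) f ≡ sumL xs f + sumL ys f
  sumL-++ [] ys f = refl
  sumL-++ (x ∷ xs) ys f = trans (cong (f x +_) (sumL-++ xs ys f)) (sym (+-assoc (f x) _ _))

  sumL-map : ∀ {B C : Set} (g : B → C) xs (f : C → ℕ) → sumL (map g xs) f ≡ sumL xs (f ∘ g)
  sumL-map g [] f = refl
  sumL-map g (x ∷ xs) f = cong (f (g x) +_) (sumL-map g xs f)

  sumL-concatMap : ∀ {B C : Set} (g : B → List C) xs (f : C → ℕ) → sumL (concatMap g xs) f ≡ sumL xs (λ x → sumL (g x) f)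
  sumL-concatMap g [] f = refl
  sumL-concatMap g (x ∷ xs) f = trans (sumL-++ (g x) (concatMap g xs) f) (cong (sumL (g x) f +_) (sumL-concatMap g xs f))

  sumL-filterᵇ : ∀ {B : Set} (p : B → Bool) xs (f : B → ℕ) → sumL (filterᵇ p xs) f ≡ sumL xs (λ x → if p x then f x else 0)
  sumL-filterᵇ p [] f = refl
  sumL-filterᵇ p (x ∷ xs) f with p x
  ... | true = cong (f x +_) (sumL-filterᵇ p xs f)
  ... | false = sumL-filterᵇ p xs f

  abstract
    ε : ∀ {k} → Vec ℕ k → Vec ℕ k → ℕ
    ε x y = if does (≡-dec ℕ._≟_ x y) then 1 else 0

    ε-refl : ∀ {k} (x : Vec ℕ k) → ε x x ≡ 1
    ε-refl x rewrite dec-true (≡-dec ℕ._≟_ x x) refl = refl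

    ε-≢ : ∀ {k} {x y : Vec ℕ k} → x ≢ y → ε x y ≡ 0
    ε-≢ {x = x} {y} ne rewrite dec-false (≡-dec ℕ._≟_ x y) ne = refl

  count-≢ : ∀ g N c (f : ℕ → ℕ) → (∀ i → g i ≢ c) → sumL (applyUpTo g N) (λ a → ε (a ∷ []) (c ∷ []) * f a) ≡ 0
  count-≢ g zero c f h = refl
  count-≢ g (suc N) c f h = cong₂ _+_ (cong (_* f (g 0)) (ε-≢ (h 0 ∘ ∷-injectiveˡ))) (count-≢ (g ∘ suc) N c f (h ∘ suc))

  -- Stated for an injective `g` because the tail of `applyUpTo g` is `applyUpTo (g ∘ suc)`.
  count-upTo : ∀ g N b (f : ℕ → ℕ) → b < N → (∀ {i j} → g i ≡ g j → i ≡ j) →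
    sumL (applyUpTo g N) (λ a → ε (a ∷ []) (g b ∷ []) * f a) ≡ f (g b)
  count-upTo g (suc N) zero f lt inj = trans (cong₂ _+_
    (trans (cong (_* f (g 0)) (ε-refl (g 0 ∷ []))) (*-identityˡ _))
    (count-≢ (g ∘ suc) N (g 0) f (λ i p → 1+n≢0 (inj p)))) (+-identityʳ _)
  count-upTo g (suc N) (suc b) f (s≤s lt) inj = cong₂ _+_
    (cong (_* f (g 0)) (ε-≢ (λ p → 0≢1+n (inj (∷-injectiveˡ p)))))
    (count-upTo (g ∘ suc) N b f lt (suc-injective ∘ inj))

  -- One-entry vectors stand for numbers, so one indicator serves for both.
  ε-∷ : ∀ {k} a b (v w : Vec ℕ k) → ε (a ∷ v) (b ∷ w) ≡ ε (a ∷ []) (b ∷ []) * ε v w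
  ε-∷ a b v w with a ℕ.≟ b
  ... | no ne = trans (ε-≢ (ne ∘ ∷-injectiveˡ)) (sym (cong (_* ε v w) (ε-≢ (ne ∘ ∷-injectiveˡ))))
  ... | yes refl with ≡-dec ℕ._≟_ v w
  ...   | yes refl = trans (ε-refl (a ∷ v)) (sym (cong₂ _*_ (ε-refl (a ∷ [])) (ε-refl v)))
  ...   | no ne = trans (ε-≢ (ne ∘ ∷-injectiveʳ)) (sym (trans (cong (ε (a ∷ []) (a ∷ []) *_) (ε-≢ ne)) (*-zeroʳ (ε (a ∷ []) (a ∷ [])))))

  comps-once : ∀ k n (v : Vec ℕ k) → Vec.sum v ≡ n → sumL (comps k n) (λ x → ε x v) ≡ 1
  comps-once zero zero [] refl = trans (+-identityʳ _) (ε-refl [])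
  comps-once (suc k) n (b ∷ v) eq = begin
    sumL (comps (suc k) n) (λ x → ε x (b ∷ v))
      ≡⟨ sumL-concatMap (λ a → map (a ∷_) (comps k (n ∸ a))) (upTo (suc n)) (λ x → ε x (b ∷ v)) ⟩
    sumL (upTo (suc n)) (λ a → sumL (map (a ∷_) (comps k (n ∸ a))) (λ x → ε x (b ∷ v)))
      ≡⟨ sumL-cong (upTo (suc n)) (λ a → trans (sumL-map (a ∷_) (comps k (n ∸ a)) _)
           (trans (sumL-cong (comps k (n ∸ a)) (λ w → ε-∷ a b w v)) (sumL-* (comps k (n ∸ a)) (ε (a ∷ []) (b ∷ [])) _))) ⟩
    sumL (upTo (suc n)) (λ a → ε (a ∷ []) (b ∷ []) * sumL (comps k (n ∸ a)) (λ w → ε w v))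
      ≡⟨ count-upTo (λ a → a) (suc n) b (λ a → sumL (comps k (n ∸ a)) (λ w → ε w v))
           (s≤s (≤-trans (m≤m+n b (Vec.sum v)) (≤-reflexive eq))) (λ p → p) ⟩
    sumL (comps k (n ∸ b)) (λ w → ε w v)
      ≡⟨ comps-once k (n ∸ b) v (sym (trans (cong (_∸ b) (sym eq)) (m+n∸m≡n b (Vec.sum v)))) ⟩
    1 ∎
    where open ≡-Reasoning

  module _ {k : ℕ} where

    private
      V : Set
      V = Vec ℕ k

    same-edge : V → V → V × V → ℕ
    same-edge u v (x , y) = ε x u * ε y v + ε x v * ε y u

    -- A matching pair is a choice of a position holding `u` and a position holding `v`, in either
    -- order. They never coincide as `u ≢ v`, so the choices multiply.
    pairs-count : ∀ (xs : List V) u v → u ≢ v →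
      sumL (pairsOf xs) (same-edge u v) ≡ sumL xs (λ x → ε x u) * sumL xs (λ x → ε x v)
    pairs-count [] u v ne = refl
    pairs-count (x ∷ xs) u v ne = begin
      sumL (map (x ,_) xs ++ pairsOf xs) (same-edge u v)
        ≡⟨ sumL-++ (map (x ,_) xs) (pairsOf xs) _ ⟩
      sumL (map (x ,_) xs) (same-edge u v) + sumL (pairsOf xs) (same-edge u v)
        ≡⟨ cong₂ _+_ (trans (sumL-map (x ,_) xs _) (trans (sumL-+ xs (λ y → ε x u * ε y v) (λ y → ε x v * ε y u))
             (cong₂ _+_ (sumL-* xs (ε x u) _) (sumL-* xs (ε x v) _)))) (pairs-count xs u v ne) ⟩
      ε x u * cv + ε x v * cu + cu * cv
        ≡⟨ cong (_+ (ε x u * cv + ε x v * cu + cu * cv)) never-both ⟨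
      ε x u * ε x v + (ε x u * cv + ε x v * cu + cu * cv)
        ≡⟨ lem (ε x u) (ε x v) cu cv ⟩
      (ε x u + cu) * (ε x v + cv) ∎
      where
      open ≡-Reasoning
      cu cv : ℕ
      cu = sumL xs (λ x → ε x u)
      cv = sumL xs (λ x → ε x v)
      lem : ∀ a b c d → a * b + (a * d + b * c + c * d) ≡ (a + c) * (b + d)
      lem = solve-∀
      never-both : ε x u * ε x v ≡ 0
      never-both with ≡-dec ℕ._≟_ x u
      ... | yes refl = trans (cong (ε x x *_) (ε-≢ ne)) (*-zeroʳ (ε x x))
      ... | no p = cong (_* ε x v) (ε-≢ p)

    same-edge-subst : ∀ (G : V → V → ℕ) → (∀ x y → G x y ≡ G y x) → ∀ u v x y →
      same-edge u v (x , y) * G x y ≡ G u v * same-edge u v (x , y)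
    same-edge-subst G Gsym u v x y with ≡-dec ℕ._≟_ x u ×-dec ≡-dec ℕ._≟_ y v | ≡-dec ℕ._≟_ x v ×-dec ≡-dec ℕ._≟_ y u
    ... | yes (refl , refl) | _ = *-comm (same-edge u v (u , v)) (G u v)
    ... | no _ | yes (refl , refl) = trans (*-comm (same-edge u v (v , u)) (G v u)) (cong (_* same-edge u v (v , u)) (Gsym v u))
    ... | no p | no r = trans (cong (_* G x y) none) (sym (trans (cong (G u v *_) none) (*-zeroʳ (G u v))))
      where
      product-zero : ∀ a b a′ b′ → ¬ (a ≡ a′ × b ≡ b′) → ε a a′ * ε b b′ ≡ 0
      product-zero a b a′ b′ ne with ≡-dec ℕ._≟_ a a′
      ... | no p = cong (_* ε b b′) (ε-≢ p)
      ... | yes p = trans (cong (ε a a′ *_) (ε-≢ (λ q → ne (p , q)))) (*-zeroʳ (ε a a′))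
      none : same-edge u v (x , y) ≡ 0
      none = cong₂ _+_ (product-zero x y u v p) (product-zero x y v u r)

    dist1-sym : ∀ {k} (x y : Vec ℕ k) → dist1 x y ≡ dist1 y x
    dist1-sym [] [] = refl
    dist1-sym (a ∷ x) (b ∷ y) = cong₂ _+_ (∣-∣-comm a b) (dist1-sym x y)

    dist1-refl : ∀ {k} (x : Vec ℕ k) → dist1 x x ≡ 0
    dist1-refl [] = refl
    dist1-refl (a ∷ x) = cong₂ _+_ (∣n-n∣≡0 a) (dist1-refl x)

    Valid : ℕ → V → V → Set
    Valid n u v = Vec.sum u ≡ n × Vec.sum v ≡ n × dist1 u v ≡ 2

    edge-once : ∀ n (H : V → V → ℕ) → (∀ x y → H x y ≡ H y x) → ∀ u v → Valid n u v →
      sumL (Edges k n) (λ p → same-edge u v p * H (proj₁ p) (proj₂ p)) ≡ H u v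
    edge-once n H Hsym u v (su , sv , dist) = begin
      sumL (Edges k n) (λ p → same-edge u v p * H (proj₁ p) (proj₂ p))
        ≡⟨ sumL-filterᵇ _ (pairsOf (comps k n)) _ ⟩
      _ ≡⟨ sumL-cong (pairsOf (comps k n)) (λ { (x , y) → trans (push (same-edge u v (x , y)) (dist1 x y ≡ᵇ 2)) (same-edge-subst G Gsym u v x y) }) ⟩
      sumL (pairsOf (comps k n)) (λ p → G u v * same-edge u v p)
        ≡⟨ sumL-* (pairsOf (comps k n)) (G u v) _ ⟩
      G u v * sumL (pairsOf (comps k n)) (same-edge u v)
        ≡⟨ cong (G u v *_) (trans (pairs-count (comps k n) u v u≢v) (cong₂ _*_ (comps-once k n u su) (comps-once k n v sv))) ⟩
      G u v * 1
        ≡⟨ *-identityʳ (G u v) ⟩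
      G u v
        ≡⟨ cong (λ z → if z ≡ᵇ 2 then H u v else 0) dist ⟩
      H u v ∎
      where
      open ≡-Reasoning
      -- The distance test that defines `Edges` is moved into the summand, leaving a sum over all
      -- pairs of points.
      G : V → V → ℕ
      G x y = if dist1 x y ≡ᵇ 2 then H x y else 0
      Gsym : ∀ x y → G x y ≡ G y x
      Gsym x y = cong₂ (λ z w → if z ≡ᵇ 2 then w else 0) (dist1-sym x y) (Hsym x y)
      push : ∀ s {h} b → (if b then s * h else 0) ≡ s * (if b then h else 0)
      push s true = refl
      push s false = sym (*-zeroʳ s)
      u≢v : u ≢ v
      u≢v refl = 0≢1+n (trans (sym (dist1-refl u)) dist)

    -- Nonnegative combinations of evaluations at edges, described by what is needed to exchange
    -- them with a finite sum. `L-cong` looks at valid pairs only, since `edge-once` holds only for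
    -- these.
    record Linear (n : ℕ) (T : (V → V → ℕ) → ℕ) : Set where
      field
        L-cong : ∀ {f g} → (∀ u v → Valid n u v → f u v ≡ g u v) → T f ≡ T g
        L-zero : T (λ _ _ → 0) ≡ 0
        L-+ : ∀ f g → T (λ u v → f u v + g u v) ≡ T f + T g

    open Linear

    lin-eval : ∀ {n} u v → Valid n u v → Linear n (λ h → h u v)
    lin-eval u v val = record { L-cong = λ h → h u v val ; L-zero = refl ; L-+ = λ _ _ → refl }

    lin-A : ∀ {n} m {T : ℕ → ℕ → (V → V → ℕ) → ℕ} → (∀ a b → a + b ≡ m → Linear n (T a b)) → Linear n (λ h → A m (λ a b → T a b h))
    lin-A m {T} lin = record
      { L-cong = λ h → A-cong m (λ a b eq → L-cong (lin a b eq) h)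
      ; L-zero = trans (A-cong m (λ a b eq → L-zero (lin a b eq))) (A-zero m)
      ; L-+ = λ f g → trans (A-cong m (λ a b eq → L-+ (lin a b eq) f g)) (A-+ m (λ a b → T a b f) (λ a b → T a b g)) }

    lin-sumF : ∀ {n} m {T : Fin m → (V → V → ℕ) → ℕ} → (∀ x → Linear n (T x)) → Linear n (λ h → sumF m (λ x → T x h))
    lin-sumF m {T} lin = record
      { L-cong = λ h → sumF-cong m (λ x → L-cong (lin x) h)
      ; L-zero = trans (sumF-cong m (λ x → L-zero (lin x))) (sumF-zero m)
      ; L-+ = λ f g → trans (sumF-cong m (λ x → L-+ (lin x) f g)) (sumF-+ m (λ x → T x f) (λ x → T x g)) }

    lin-plus : ∀ {n T U} → Linear n T → Linear n U → Linear n (λ h → T h + U h)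
    lin-plus {T = T} {U} lT lU = record
      { L-cong = λ h → cong₂ _+_ (L-cong lT h) (L-cong lU h)
      ; L-zero = cong₂ _+_ (L-zero lT) (L-zero lU)
      ; L-+ = λ f g → trans (cong₂ _+_ (L-+ lT f g) (L-+ lU f g)) (lem (T f) (T g) (U f) (U g)) }
      where
      lem : ∀ x y z t → x + y + (z + t) ≡ x + z + (y + t)
      lem = solve-∀

    -- The alternative `c ≡ 0` handles triples and pairs with repeated indices, which may yield
    -- pairs that are not edges but carry coefficient zero.
    lin-scale : ∀ {n} c {T} → c ≡ 0 ⊎ Linear n T → Linear n (λ h → c * T h)
    lin-scale c (inj₁ refl) = record { L-cong = λ _ → refl ; L-zero = refl ; L-+ = λ _ _ → refl }
    lin-scale c {T} (inj₂ lT) = record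
      { L-cong = λ h → cong (c *_) (L-cong lT h)
      ; L-zero = trans (cong (c *_) (L-zero lT)) (*-zeroʳ c)
      ; L-+ = λ f g → trans (cong (c *_) (L-+ lT f g)) (*-distribˡ-+ c (T f) (T g)) }

    lin-sumL : ∀ {n T} → Linear n T → ∀ {B : Set} (xs : List B) (g : B → V → V → ℕ) →
      sumL xs (λ x → T (g x)) ≡ T (λ u v → sumL xs (λ x → g x u v))
    lin-sumL lT [] g = sym (L-zero lT)
    lin-sumL {T = T} lT (x ∷ xs) g = trans (cong (T (g x) +_) (lin-sumL lT xs g)) (sym (L-+ lT (g x) _))

    lin-* : ∀ {n T} → Linear n T → ∀ c f → T (λ u v → c * f u v) ≡ c * T f
    lin-* lT zero f = L-zero lT
    lin-* {T = T} lT (suc c) f = trans (L-+ lT f (λ u v → c * f u v)) (cong (T f +_) (lin-* lT c f))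

    -- The value of `T` at `same-edge` is the multiplicity of the edge `p` in `T`. Exchanging the
    -- sums reduces the claim to `edge-once`. It is used with `H` constantly 1 for the LP value and
    -- with the cut indicator for the cost.
    edges-sum : ∀ {n T} → Linear n T → (H : V → V → ℕ) → (∀ x y → H x y ≡ H y x) →
      sumL (Edges k n) (λ p → H (proj₁ p) (proj₂ p) * T (λ u v → same-edge u v p)) ≡ T H
    edges-sum {n} {T} lT H Hsym = begin
      sumL (Edges k n) (λ p → H (proj₁ p) (proj₂ p) * T (λ u v → same-edge u v p))
        ≡⟨ sumL-cong (Edges k n) (λ p → sym (lin-* lT (H (proj₁ p) (proj₂ p)) (λ u v → same-edge u v p))) ⟩
      sumL (Edges k n) (λ p → T (λ u v → H (proj₁ p) (proj₂ p) * same-edge u v p))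
        ≡⟨ lin-sumL lT (Edges k n) (λ p u v → H (proj₁ p) (proj₂ p) * same-edge u v p) ⟩
      T (λ u v → sumL (Edges k n) (λ p → H (proj₁ p) (proj₂ p) * same-edge u v p))
        ≡⟨ L-cong lT (λ u v val → trans (sumL-cong (Edges k n) (λ p → *-comm (H (proj₁ p) (proj₂ p)) (same-edge u v p)))
             (edge-once n H Hsym u v val)) ⟩
      T H ∎
      where open ≡-Reasoning

    sum-tabulate : ∀ {m} (f : Fin m → ℕ) → Vec.sum (tabulate f) ≡ sumF m f
    sum-tabulate {zero} f = refl
    sum-tabulate {suc m} f = cong (f zero +_) (sum-tabulate (f ∘ suc))

    dist1-tabulate : ∀ {m} (f g : Fin m → ℕ) → dist1 (tabulate f) (tabulate g) ≡ sumF m (λ x → ∣ f x - g x ∣)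
    dist1-tabulate {zero} f g = refl
    dist1-tabulate {suc m} f g = cong (∣ f zero - g zero ∣ +_) (dist1-tabulate (f ∘ suc) (g ∘ suc))

    sumF-e′ : ∀ (i : Fin k) → sumF k (λ x → e x i) ≡ 1
    sumF-e′ i = trans (sumF-cong k (λ x → e-sym x i)) (sumF-e i)

    pt-sum : ∀ (i j l : Fin k) a b c → Vec.sum (pt i j l a b c) ≡ a + (b + c)
    pt-sum i j l a b c = trans (sum-tabulate (λ x → a * e x i + (b * e x j + c * e x l))) (trans (sumF-+ k _ _)
      (cong₂ _+_ (scaled a i) (trans (sumF-+ k _ _) (cong₂ _+_ (scaled b j) (scaled c l)))))
      where
      scaled : ∀ a (i : Fin k) → sumF k (λ x → a * e x i) ≡ a
      scaled a i = trans (sumF-* k a _) (trans (cong (a *_) (sumF-e′ i)) (*-identityʳ a))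

    pt-dist : ∀ (i j l : Fin k) a b c → j ≢ l → dist1 (pt i j l a (suc b) c) (pt i j l a b (suc c)) ≡ 2
    pt-dist i j l a b c j≢l = trans (dist1-tabulate
      (λ x → a * e x i + (suc b * e x j + c * e x l)) (λ x → a * e x i + (b * e x j + suc c * e x l))) (trans (sumF-cong k pointwise)
      (trans (sumF-+ k _ _) (cong₂ _+_ (sumF-e′ j) (sumF-e′ l))))
      where
      lem₁ : ∀ p q r s → p + ((q + r) + s) ≡ (p + r + s) + q
      lem₁ = solve-∀
      lem₂ : ∀ p q r s → p + (r + (q + s)) ≡ (p + r + s) + q
      lem₂ = solve-∀
      unequal : ∀ x → ∣ e x j - e x l ∣ ≡ e x j + e x l
      unequal x with x ≟ j
      ... | no ne rewrite e-≢ ne = refl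
      ... | yes refl rewrite e-refl x | e-≢ j≢l = refl
      pointwise : ∀ x → ∣ a * e x i + (suc b * e x j + c * e x l) - a * e x i + (b * e x j + suc c * e x l) ∣ ≡ e x j + e x l
      pointwise x = trans (cong₂ ∣_-_∣ (lem₁ (a * e x i) (e x j) (b * e x j) (c * e x l)) (lem₂ (a * e x i) (e x l) (b * e x j) (c * e x l)))
        (trans (∣m+n-m+o∣≡∣n-o∣ (a * e x i + b * e x j + c * e x l) _ _) (unequal x))

    pt-valid : ∀ M (i j l : Fin k) a b c → j ≢ l → a + (b + c) ≡ M → Valid (suc M) (pt i j l a (suc b) c) (pt i j l a b (suc c))
    pt-valid M i j l a b c j≢l refl =
      trans (pt-sum i j l a (suc b) c) (+-suc a (b + c)) ,
      trans (pt-sum i j l a b (suc c)) (trans (cong (a +_) (+-suc b c)) (+-suc a (b + c))) ,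
      pt-dist i j l a b c j≢l

    total-linear : ∀ q m → Linear (suc (suc m)) (Weights.total {k} q m)
    total-linear q m = lin-plus
      (lin-sumF k (λ i → lin-sumF k (λ j → lin-sumF k (λ l → lin-scale (distinct₃ i j l) (tri i j l)))))
      (lin-sumF k (λ i → lin-sumF k (λ j → lin-scale (d i j) (line i j))))
      where
      open Weights {k} q m
      tri : ∀ i j l → distinct₃ i j l ≡ 0 ⊎ Linear (suc M) (triangle-sum i j l)
      tri i j l with distinct₃-cases i j l
      ... | inj₁ z = inj₁ z
      ... | inj₂ (_ , j≢l , _) = inj₂ (lin-plus
        (lin-A M {λ a r h → A r (λ b c → le a t * h (pt i j l a (suc b) c) (pt i j l a b (suc c)))}
          (λ a r eq → lin-A r {λ b c h → le a t * h (pt i j l a (suc b) c) (pt i j l a b (suc c))}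
            (λ b c eq′ → lin-scale (le a t) (inj₂ (lin-eval (pt i j l a (suc b) c) (pt i j l a b (suc c))
              (pt-valid M i j l a b c j≢l (trans (cong (a +_) eq′) eq)))))))
        (lin-A M {λ b c h → ((b ∸ t) + (c ∸ t)) * h (pt i j l 0 (suc b) c) (pt i j l 0 b (suc c))}
          (λ b c eq → lin-scale ((b ∸ t) + (c ∸ t)) (inj₂ (lin-eval (pt i j l 0 (suc b) c) (pt i j l 0 b (suc c))
            (pt-valid M i j l 0 b c j≢l eq))))))
      line : ∀ i j → d i j ≡ 0 ⊎ Linear (suc M) (λ h → 2 * q * line-sum i j h)
      line i j with i ≟ j
      ... | yes p = inj₁ (d-≡ p)
      -- A point of the segment is a `pt` with first coefficient 0, whose first index is arbitrary;
      -- here it is `i`.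
      ... | no ne = inj₂ (lin-scale (2 * q) (inj₂ (lin-A M {λ a b h → h (ln i j (suc a) b) (ln i j a (suc b))}
        (λ a b eq → lin-eval (ln i j (suc a) b) (ln i j a (suc b)) (pt-valid M i i j 0 a b ne eq)))))

  -- Total weight

  inner-total : ∀ t j → 2 * A (t + j) (λ a r → le a t * suc r) ≡ suc t * (2 * j + t + 2)
  inner-total zero zero = refl
  inner-total zero (suc j) = trans (cong (2 *_) (cong (1 * suc (suc j) +_) (A-zero j))) (lem j)
    where
    lem : ∀ j → 2 * (1 * (2 + j) + 0) ≡ 1 * (2 * (1 + j) + 0 + 2)
    lem = solve-∀
  inner-total (suc t) j = trans (*-distribˡ-+ 2 (1 * suc (suc (t + j))) _)
    (trans (cong (2 * (1 * suc (suc (t + j))) +_) (inner-total t j)) (lem t j))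
    where
    lem : ∀ t j → 2 * (1 * (2 + (t + j))) + (1 + t) * (2 * j + t + 2) ≡ (2 + t) * (2 * j + (1 + t) + 2)
    lem = solve-∀

  side-total : ∀ t j → 2 * A (t + j) (λ b c → c ∸ t) ≡ j * suc j
  side-total t zero = trans (cong (2 *_) (trans (A-cong (t + 0) (λ b c eq → m≤n⇒m∸n≡0
    (≤-trans (m≤n+m c b) (≤-reflexive (trans eq (+-identityʳ t)))))) (A-zero (t + 0)))) refl
  side-total t (suc j) rewrite +-suc t j = trans (*-distribˡ-+ 2 (suc (t + j) ∸ t) _)
    (trans (cong₂ (λ x y → 2 * x + y) (trans (cong (_∸ t) (sym (+-suc t j))) (m+n∸m≡n t (suc j))) (side-total t j)) (lem j))
    where
    lem : ∀ j → 2 * (1 + j) + j * (1 + j) ≡ (1 + j) * (2 + j)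
    lem = solve-∀

  module _ (q m k′ : ℕ) (mq : suc (suc m) ≡ q + q + q) where

    private
      k : ℕ
      k = suc (suc k′)

    open Weights {k} q m

    one : Vec ℕ k → Vec ℕ k → ℕ
    one _ _ = 1

    -- With `t = 2q` and `j = q - 1` in the two sums above, the rows give 4q² + 2q and the two ends
    -- of the side together q² - q.
    triangle-weight : ∀ i j l → triangle-sum i j l one ≡ 5 * (q * q) + q
    triangle-weight i j l = *-cancelˡ-≡ _ _ 2 (trans (*-distribˡ-+ 2 (S M (λ a b c → le a t * 1)) _)
      (trans (cong₂ (λ x y → 2 * x + 2 * y) rows (trans (A-cong M (λ b c _ → *-identityʳ ((b ∸ t) + (c ∸ t)))) (trans (A-+ M (λ b c → b ∸ t) (λ b c → c ∸ t))
        (cong (_+ A M (λ b c → c ∸ t)) (A-swap M (λ b c → b ∸ t)))))) (by-q M q mq)))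
      where
      rows : S M (λ a b c → le a t * 1) ≡ A M (λ a r → le a t * suc r)
      rows = A-cong M (λ a r _ → trans (A-* r (le a t) (λ _ _ → 1)) (cong (le a t *_) (A-one r)))
      by-q : ∀ M q → suc M ≡ q + q + q → let t = q + q in
        2 * A M (λ a r → le a t * suc r) + 2 * (A M (λ b c → c ∸ t) + A M (λ b c → c ∸ t)) ≡ 2 * (5 * (q * q) + q)
      by-q M zero ()
      by-q M (suc j) eq with suc-injective (trans eq (+-suc (suc j + suc j) j))
      ... | refl = trans (cong₂ _+_ (inner-total s j)
        (trans (*-distribˡ-+ 2 (A (s + j) (λ b c → c ∸ s)) _) (cong₂ _+_ (side-total s j) (side-total s j)))) (lem j)
        where
        s : ℕ
        s = suc j + suc j
        lem : ∀ j → (1 + ((1 + j) + (1 + j))) * (2 * j + ((1 + j) + (1 + j)) + 2) + (j * (1 + j) + j * (1 + j)) ≡ 2 * (5 * ((1 + j) * (1 + j)) + (1 + j))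
        lem = solve-∀

    sumF-d : ∀ (i : Fin k) → sumF k (d i) ≡ suc k′
    sumF-d i = suc-injective (trans (cong (_+ sumF k (d i)) (sym (sumF-e i)))
      (trans (sym (sumF-+ k (e i) (d i))) (trans (sumF-cong k (e+d i)) (sumF-one k))))

    sumF-dd : ∀ (i j : Fin k) → i ≢ j → sumF k (λ l → d j l * d l i) ≡ k′
    sumF-dd i j i≢j = suc-injective (suc-injective (trans
      (cong₂ (λ x y → x + (y + sumF k dd)) (sym (sumF-e i)) (sym (sumF-e j)))
      (trans (trans (cong (sumF k (e i) +_) (sym (sumF-+ k (e j) dd))) (sym (sumF-+ k (e i) (λ l → e j l + dd l))))
        (trans (sumF-cong k pointwise) (sumF-one k)))))
      where
      dd : Fin k → ℕ
      dd l = d j l * d l i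
      pointwise : ∀ l → e i l + (e j l + d j l * d l i) ≡ 1
      pointwise l with i ≟ l | j ≟ l
      ... | yes refl | _ rewrite e-refl i | e-≢ (i≢j ∘ sym) | d-refl i | *-zeroʳ (d j i) = refl
      ... | no ne | yes refl rewrite e-refl j | e-≢ ne | d-refl j = refl
      ... | no ne | no ne′ rewrite e-≢ ne | e-≢ ne′ | d-≢ ne′ | d-≢ (ne ∘ sym) = refl

    pairs-number : sum² k d ≡ k * suc k′
    pairs-number = trans (sumF-cong k (λ i → trans (sumF-d i) (sym (*-identityʳ (suc k′)))))
      (trans (sumF-* k (suc k′) (λ _ → 1)) (trans (cong (suc k′ *_) (sumF-one k)) (*-comm (suc k′) k)))

    triples-number : sum³ k distinct₃ ≡ k′ * sum² k d
    triples-number = trans (sumF-cong k (λ i → sumF-cong k (λ j → trans (sumF-* k (d i j) (λ l → d j l * d l i)) (step i j)))) (sum²-* k k′ d)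
      where
      step : ∀ i j → d i j * sumF k (λ l → d j l * d l i) ≡ k′ * d i j
      step i j with i ≟ j
      ... | yes p rewrite d-≡ p = sym (*-zeroʳ k′)
      ... | no ne = trans (cong (d i j *_) (sumF-dd i j ne)) (*-comm (d i j) k′)

    total-one : total one ≡ sum² k d * (k′ * (5 * (q * q) + q) + 6 * (q * q))
    total-one = trans (cong₂ _+_
      (trans (sum³-cong k (λ i j l → trans (cong (distinct₃ i j l *_) (triangle-weight i j l)) (*-comm (distinct₃ i j l) w)))
        (trans (sum³-* k w distinct₃) (cong (w *_) triples-number)))
      (trans (sumF-cong k (λ i → sumF-cong k (λ j → trans (cong (λ z → d i j * (2 * q * z)) (trans (A-one M) mq)) (*-comm (d i j) (2 * q * (q + q + q))))))
        (sum²-* k (2 * q * (q + q + q)) d)))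
      (lem w k′ (sum² k d) q)
      where
      w : ℕ
      w = 5 * (q * q) + q
      lem : ∀ w k′ p q → w * (k′ * p) + 2 * q * (q + q + q) * p ≡ p * (k′ * w + 6 * (q * q))
      lem = solve-∀

-- Normalised weights and rational bounds

module Rationals where

  open Combinatorics
  open import Data.Nat as ℕ using (ℕ; zero; suc)
  import Data.Nat.Properties as ℕ
  open import Data.Nat.Tactic.RingSolver using (solve-∀)
  open import Data.Fin using (_≟_)
  open import Data.Vec using (Vec)
  open import Data.Integer using (+_)
  import Data.Integer as ℤ
  import Data.Integer.Properties as ℤ
  open import Data.Rational using (ℚ; _/_; _+_; _*_; _≤_; 0ℚ; 1ℚ; toℚᵘ; nonNegative; Positive; positive)
  import Data.Rational.Properties as ℚ
  open import Data.Rational.Unnormalised as ℚᵘ using (mkℚᵘ; *≡*; *≤*)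
  import Data.Rational.Unnormalised.Properties as ℚᵘ
  open import Data.Rational.Solver using (module +-*-Solver)
  open import Data.List using (List; []; _∷_; map)
  open import Data.Product using (Σ; _,_; proj₁; proj₂)
  open import Data.Bool using (if_then_else_)
  open import Relation.Nullary using (yes; no; does)
  open import Relation.Binary.PropositionalEquality hiding (J)
  open import Defs

  toℚᵘ-/ : ∀ a b → toℚᵘ (+ a / suc b) ℚᵘ.≃ mkℚᵘ (+ a) b
  toℚᵘ-/ a b = ℚ.toℚᵘ-fromℚᵘ (mkℚᵘ (+ a) b)

  toℚ-+ : ∀ a b → toℚ (a ℕ.+ b) ≡ toℚ a + toℚ b
  toℚ-+ a b = ℚ.toℚᵘ-injective (ℚᵘ.≃-trans (toℚᵘ-/ (a ℕ.+ b) 0) (ℚᵘ.≃-trans (*≡* (eq a b))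
    (ℚᵘ.≃-sym (ℚᵘ.≃-trans (ℚ.toℚᵘ-homo-+ (toℚ a) (toℚ b)) (ℚᵘ.+-cong (toℚᵘ-/ a 0) (toℚᵘ-/ b 0))))))
    where
    eq : ∀ a b → (+ (a ℕ.+ b)) ℤ.* + 1 ≡ ((+ a) ℤ.* + 1 ℤ.+ (+ b) ℤ.* + 1) ℤ.* + 1
    eq a b rewrite ℤ.*-identityʳ (+ a) | ℤ.*-identityʳ (+ b) = refl

  toℚ-* : ∀ a b → toℚ (a ℕ.* b) ≡ toℚ a * toℚ b
  toℚ-* a b = ℚ.toℚᵘ-injective (ℚᵘ.≃-trans (toℚᵘ-/ (a ℕ.* b) 0) (ℚᵘ.≃-trans (*≡* (cong (ℤ._* + 1) (ℤ.pos-* a b)))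
    (ℚᵘ.≃-sym (ℚᵘ.≃-trans (ℚ.toℚᵘ-homo-* (toℚ a) (toℚ b)) (ℚᵘ.*-cong (toℚᵘ-/ a 0) (toℚᵘ-/ b 0))))))

  toℚ-mono : ∀ {a b} → a ℕ.≤ b → toℚ a ≤ toℚ b
  toℚ-mono {a} {b} h = ℚ.toℚᵘ-cancel-≤ (ℚᵘ.≤-respˡ-≃ (ℚᵘ.≃-sym (toℚᵘ-/ a 0)) (ℚᵘ.≤-respʳ-≃ (ℚᵘ.≃-sym (toℚᵘ-/ b 0))
    (*≤* (subst₂ ℤ._≤_ (sym (ℤ.*-identityʳ (+ a))) (sym (ℤ.*-identityʳ (+ b))) (ℤ.+≤+ h)))))

  inv-* : ∀ d → inv (suc d) * toℚ (suc d) ≡ 1ℚ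
  inv-* d = ℚ.toℚᵘ-injective (ℚᵘ.≃-trans (ℚ.toℚᵘ-homo-* (inv (suc d)) (toℚ (suc d)))
    (ℚᵘ.≃-trans (ℚᵘ.*-cong (toℚᵘ-/ 1 d) (toℚᵘ-/ (suc d) 0)) (*≡* (cong +_ (lem d)))))
    where
    lem : ∀ d → (1 ℕ.* suc d) ℕ.* 1 ≡ 1 ℕ.* (suc d ℕ.* 1)
    lem = solve-∀

  0≤inv : ∀ d → 0ℚ ≤ inv d
  0≤inv zero = ℚ.≤-refl
  0≤inv (suc d) = ℚ.toℚᵘ-cancel-≤ (ℚᵘ.≤-respʳ-≃ (ℚᵘ.≃-sym (toℚᵘ-/ 1 d)) (*≤* (ℤ.+≤+ ℕ.z≤n)))

  inv-mono : ∀ d {p q} → p ≤ q → inv d * p ≤ inv d * q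
  inv-mono d = ℚ.*-monoˡ-≤-nonNeg (inv d) {{nonNegative (0≤inv d)}}

  0≤inv*toℚ : ∀ d a → 0ℚ ≤ inv d * toℚ a
  0≤inv*toℚ d a = subst (_≤ inv d * toℚ a) (ℚ.*-zeroʳ (inv d)) (inv-mono d (toℚ-mono {0} {a} ℕ.z≤n))

  sumℚ-map : ∀ {B : Set} (r : ℚ) (xs : List B) (f : B → ℚ) (g : B → ℕ) → (∀ p → f p ≡ r * toℚ (g p)) →
    sumℚ (map f xs) ≡ r * toℚ (sumL xs g)
  sumℚ-map r [] f g h = sym (ℚ.*-zeroʳ r)
  sumℚ-map r (x ∷ xs) f g h = trans (cong₂ _+_ (h x) (sumℚ-map r xs f g h))
    (trans (sym (ℚ.*-distribˡ-+ r (toℚ (g x)) (toℚ (sumL xs g)))) (cong (r *_) (sym (toℚ-+ (g x) (sumL xs g)))))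

  -- All denominators are cleared by multiplying with 6 · n · N · k.
  gap-bound : ∀ n′ N′ k′ T → let n = suc n′; N = suc N′; k = suc k′ in
    6 ℕ.* (T ℕ.* k) ℕ.≤ (5 ℕ.* k ℕ.+ 1) ℕ.* (n ℕ.* N) ℕ.+ 6 ℕ.* (N ℕ.* k) →
    inv n * (inv N * toℚ T) ≤ (+ 1 / 6) * (toℚ 5 + inv k) + 1ℚ * inv n
  gap-bound n′ N′ k′ T h = ℚ.*-cancelʳ-≤-pos s {{spos}} (subst₂ _≤_ (sym left) (sym right) (toℚ-mono h))
    where
    open +-*-Solver
    n N k s₀ : ℕ
    n = suc n′
    N = suc N′
    k = suc k′
    s₀ = 6 ℕ.* (n ℕ.* (N ℕ.* k))
    s : ℚ
    s = toℚ s₀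
    spos : Positive s
    spos = positive (ℚ.<-≤-trans {0ℚ} {1ℚ} (ℚ.positive⁻¹ 1ℚ) (toℚ-mono {1} {s₀} (ℕ.s≤s ℕ.z≤n)))
    s-split : s ≡ toℚ 6 * (toℚ n * (toℚ N * toℚ k))
    s-split = trans (toℚ-* 6 (n ℕ.* (N ℕ.* k))) (cong (toℚ 6 *_) (trans (toℚ-* n (N ℕ.* k)) (cong (toℚ n *_) (toℚ-* N k))))
    left : inv n * (inv N * toℚ T) * s ≡ toℚ (6 ℕ.* (T ℕ.* k))
    left = begin
      inv n * (inv N * toℚ T) * s
        ≡⟨ cong (inv n * (inv N * toℚ T) *_) s-split ⟩
      inv n * (inv N * toℚ T) * (toℚ 6 * (toℚ n * (toℚ N * toℚ k)))
        ≡⟨ solve 7 (λ a b t x n N k → a :* (b :* t) :* (x :* (n :* (N :* k))) := (a :* n) :* ((b :* N) :* (x :* (t :* k)))) refl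
             (inv n) (inv N) (toℚ T) (toℚ 6) (toℚ n) (toℚ N) (toℚ k) ⟩
      (inv n * toℚ n) * ((inv N * toℚ N) * (toℚ 6 * (toℚ T * toℚ k)))
        ≡⟨ cong₂ (λ x y → x * (y * (toℚ 6 * (toℚ T * toℚ k)))) (inv-* n′) (inv-* N′) ⟩
      1ℚ * (1ℚ * (toℚ 6 * (toℚ T * toℚ k)))
        ≡⟨ trans (ℚ.*-identityˡ _) (ℚ.*-identityˡ _) ⟩
      toℚ 6 * (toℚ T * toℚ k)
        ≡⟨ trans (toℚ-* 6 (T ℕ.* k)) (cong (toℚ 6 *_) (toℚ-* T k)) ⟨
      toℚ (6 ℕ.* (T ℕ.* k)) ∎
      where open ≡-Reasoning
    right : ((+ 1 / 6) * (toℚ 5 + inv k) + 1ℚ * inv n) * s ≡ toℚ ((5 ℕ.* k ℕ.+ 1) ℕ.* (n ℕ.* N) ℕ.+ 6 ℕ.* (N ℕ.* k))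
    right = begin
      ((+ 1 / 6) * (toℚ 5 + inv k) + 1ℚ * inv n) * s
        ≡⟨ cong (((+ 1 / 6) * (toℚ 5 + inv k) + 1ℚ * inv n) *_) s-split ⟩
      ((+ 1 / 6) * (toℚ 5 + inv k) + 1ℚ * inv n) * (toℚ 6 * (toℚ n * (toℚ N * toℚ k)))
        ≡⟨ solve 9 (λ u f c o a x n N k → (u :* (f :+ c) :+ o :* a) :* (x :* (n :* (N :* k))) :=
             (u :* x) :* ((f :* k :+ c :* k) :* (n :* N)) :+ o :* ((a :* n) :* (x :* (N :* k)))) refl
             (+ 1 / 6) (toℚ 5) (inv k) 1ℚ (inv n) (toℚ 6) (toℚ n) (toℚ N) (toℚ k) ⟩
      ((+ 1 / 6) * toℚ 6) * ((toℚ 5 * toℚ k + inv k * toℚ k) * (toℚ n * toℚ N)) + 1ℚ * ((inv n * toℚ n) * (toℚ 6 * (toℚ N * toℚ k)))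
        ≡⟨ cong₂ (λ x y → ((+ 1 / 6) * toℚ 6) * ((toℚ 5 * toℚ k + x) * (toℚ n * toℚ N)) + 1ℚ * (y * (toℚ 6 * (toℚ N * toℚ k)))) (inv-* k′) (inv-* n′) ⟩
      1ℚ * ((toℚ 5 * toℚ k + 1ℚ) * (toℚ n * toℚ N)) + 1ℚ * (1ℚ * (toℚ 6 * (toℚ N * toℚ k)))
        ≡⟨ cong₂ _+_ (ℚ.*-identityˡ ((toℚ 5 * toℚ k + 1ℚ) * (toℚ n * toℚ N)))
             (trans (ℚ.*-identityˡ (1ℚ * (toℚ 6 * (toℚ N * toℚ k)))) (ℚ.*-identityˡ (toℚ 6 * (toℚ N * toℚ k)))) ⟩
      (toℚ 5 * toℚ k + 1ℚ) * (toℚ n * toℚ N) + toℚ 6 * (toℚ N * toℚ k)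
        ≡⟨ trans (toℚ-+ ((5 ℕ.* k ℕ.+ 1) ℕ.* (n ℕ.* N)) (6 ℕ.* (N ℕ.* k))) (cong₂ _+_
             (trans (toℚ-* (5 ℕ.* k ℕ.+ 1) (n ℕ.* N)) (cong₂ _*_ (trans (toℚ-+ (5 ℕ.* k) 1) (cong (_+ 1ℚ) (toℚ-* 5 k))) (toℚ-* n N)))
             (trans (toℚ-* 6 (N ℕ.* k)) (cong (toℚ 6 *_) (toℚ-* N k)))) ⟨
      toℚ ((5 ℕ.* k ℕ.+ 1) ℕ.* (n ℕ.* N) ℕ.+ 6 ℕ.* (N ℕ.* k)) ∎
      where open ≡-Reasoning

  -- The factor `1` gives the sum the shape of `edges-sum`, with the constant function in place of
  -- the cut indicator.
  LP-count : ∀ k n r (g : Vec ℕ k → Vec ℕ k → ℕ) → LP k n (λ x y → r * toℚ (g x y)) ≡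
    inv n * (r * toℚ (sumL (Edges k n) (λ p → 1 ℕ.* g (proj₁ p) (proj₂ p))))
  LP-count k n r g = cong (inv n *_) (sumℚ-map r (Edges k n) _ (λ p → 1 ℕ.* g (proj₁ p) (proj₂ p))
    (λ { (x , y) → cong (λ z → r * toℚ z) (sym (ℕ.*-identityˡ (g x y))) }))

  cost-count : ∀ k n (P : Cut k n) r (g : Vec ℕ k → Vec ℕ k → ℕ) → cost k n P (λ x y → r * toℚ (g x y)) ≡
    r * toℚ (sumL (Edges k n) (λ p → d (P (proj₁ p)) (P (proj₂ p)) ℕ.* g (proj₁ p) (proj₂ p)))
  cost-count k n P r g = sumℚ-map r (Edges k n) _ (λ p → d (P (proj₁ p)) (P (proj₂ p)) ℕ.* g (proj₁ p) (proj₂ p))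
    (λ { (x , y) → term x y })
    where
    term : ∀ x y → (if does (P x ≟ P y) then 0ℚ else r * toℚ (g x y)) ≡ r * toℚ (d (P x) (P y) ℕ.* g x y)
    term x y with P x ≟ P y
    ... | yes p = sym (trans (cong (λ z → r * toℚ (z ℕ.* g x y)) (d-≡ p)) (ℚ.*-zeroʳ r))
    ... | no ne = sym (trans (cong (λ z → r * toℚ (z ℕ.* g x y)) (d-≢ ne)) (cong (λ z → r * toℚ z) (ℕ.*-identityˡ (g x y))))

  LP-linear : ∀ {k n T} → Linear {k} n T → ∀ r →
    LP k n (λ x y → r * toℚ (T (λ u v → same-edge u v (x , y)))) ≡ inv n * (r * toℚ (T (λ _ _ → 1)))
  LP-linear {k} {n} {T} lT r = trans (LP-count k n r (λ x y → T (λ u v → same-edge u v (x , y))))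
    (cong (λ z → inv n * (r * toℚ z)) (edges-sum lT (λ _ _ → 1) (λ _ _ → refl)))

  cost-linear : ∀ {k n T} → Linear {k} n T → ∀ (P : Cut k n) r →
    cost k n P (λ x y → r * toℚ (T (λ u v → same-edge u v (x , y)))) ≡ r * toℚ (T (λ u v → d (P u) (P v)))
  cost-linear {k} {n} {T} lT P r = trans (cost-count k n P r (λ x y → T (λ u v → same-edge u v (x , y))))
    (cong (λ z → r * toℚ z) (edges-sum lT (λ x y → d (P x) (P y)) (λ x y → d-sym (P x) (P y))))

  -- The case n = 3q, k = k′ + 2, written with m = n - 2.
  module Construction (q m k′ : ℕ) (mq : suc (suc m) ≡ q ℕ.+ q ℕ.+ q) where

    private
      n k : ℕ
      n = suc (suc m)
      k = suc (suc k′)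

    open Weights {k} q m using (total; module CutBound)

    -- The lower bound of `cut-bound`; dividing by it normalises the cost of every cut to at least
    -- 1.
    threshold : ℕ
    threshold = 2 ℕ.* q ℕ.* (sum³ k distinct₃ ℕ.+ sum² k d)

    count : Vec ℕ k → Vec ℕ k → ℕ
    count x y = total (λ u v → same-edge u v (x , y))

    weight : Weight k
    weight x y = inv threshold * toℚ (count x y)

    threshold-value : threshold ≡ 2 ℕ.* q ℕ.* (suc k′ ℕ.* sum² k d)
    threshold-value = cong (2 ℕ.* q ℕ.*_) (trans (cong (ℕ._+ sum² k d) (triples-number q m k′ mq)) (ℕ.+-comm (k′ ℕ.* sum² k d) (sum² k d)))

    -- Needed because `inv zero` is 0, so normalising works only for a nonzero threshold.
    threshold-positive : Σ ℕ λ N → threshold ≡ suc N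
    threshold-positive = nonzero q mq
      where
      p : ℕ
      p = suc k′ ℕ.* (k ℕ.* suc k′)
      nonzero : ∀ r → n ≡ r ℕ.+ r ℕ.+ r → Σ ℕ λ N → 2 ℕ.* r ℕ.* (sum³ k distinct₃ ℕ.+ sum² k d) ≡ suc N
      nonzero zero ()
      nonzero (suc j) _ = ℕ.pred (2 ℕ.* suc j ℕ.* p) , cong (2 ℕ.* suc j ℕ.*_) (trans
        (cong (ℕ._+ sum² k d) (triples-number q m k′ mq))
        (trans (ℕ.+-comm (k′ ℕ.* sum² k d) (sum² k d)) (cong (suc k′ ℕ.*_) (pairs-number q m k′ mq))))

    LP-value : LP k n weight ≡ inv n * (inv threshold * toℚ (total (one q m k′ mq)))
    LP-value = LP-linear {k} {n} {total} (total-linear q m) (inv threshold)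

    -- The terms quadratic in `q` give the main term exactly. The term `q` of each triangle
    -- direction adds k′/(2(k′+1)n), which the constant 1 covers; `lem` exhibits the slack.
    LP-bound : LP k n weight ≤ (+ 1 / 6) * (toℚ 5 + inv (suc k′)) + 1ℚ * inv n
    LP-bound = subst (_≤ (+ 1 / 6) * (toℚ 5 + inv (suc k′)) + 1ℚ * inv n) (sym LP-value) (bound (proj₁ threshold-positive) (proj₂ threshold-positive))
      where
      p : ℕ
      p = sum² k d
      lem : ∀ q k p → 6 ℕ.* (p ℕ.* (k ℕ.* (5 ℕ.* (q ℕ.* q) ℕ.+ q) ℕ.+ 6 ℕ.* (q ℕ.* q)) ℕ.* (1 ℕ.+ k)) ℕ.+ (6 ℕ.* (q ℕ.* (p ℕ.* (k ℕ.* (1 ℕ.+ k)))) ℕ.+ 12 ℕ.* (q ℕ.* (p ℕ.* (1 ℕ.+ k))))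
        ≡ (5 ℕ.* (1 ℕ.+ k) ℕ.+ 1) ℕ.* ((q ℕ.+ q ℕ.+ q) ℕ.* (2 ℕ.* q ℕ.* ((1 ℕ.+ k) ℕ.* p))) ℕ.+ 6 ℕ.* (2 ℕ.* q ℕ.* ((1 ℕ.+ k) ℕ.* p) ℕ.* (1 ℕ.+ k))
      lem = solve-∀
      numerators : 6 ℕ.* (total (one q m k′ mq) ℕ.* suc k′) ℕ.≤
        (5 ℕ.* suc k′ ℕ.+ 1) ℕ.* (n ℕ.* threshold) ℕ.+ 6 ℕ.* (threshold ℕ.* suc k′)
      numerators = begin
        6 ℕ.* (total (one q m k′ mq) ℕ.* suc k′)
          ≡⟨ cong (λ z → 6 ℕ.* (z ℕ.* suc k′)) (total-one q m k′ mq) ⟩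
        6 ℕ.* (p ℕ.* (k′ ℕ.* (5 ℕ.* (q ℕ.* q) ℕ.+ q) ℕ.+ 6 ℕ.* (q ℕ.* q)) ℕ.* suc k′)
          ≤⟨ ℕ.m≤m+n _ _ ⟩
        _ ≡⟨ lem q k′ p ⟩
        (5 ℕ.* suc k′ ℕ.+ 1) ℕ.* ((q ℕ.+ q ℕ.+ q) ℕ.* (2 ℕ.* q ℕ.* (suc k′ ℕ.* p))) ℕ.+ 6 ℕ.* (2 ℕ.* q ℕ.* (suc k′ ℕ.* p) ℕ.* suc k′)
          ≡⟨ cong₂ (λ x y → (5 ℕ.* suc k′ ℕ.+ 1) ℕ.* (x ℕ.* y) ℕ.+ 6 ℕ.* (y ℕ.* suc k′)) mq threshold-value ⟨
        (5 ℕ.* suc k′ ℕ.+ 1) ℕ.* (n ℕ.* threshold) ℕ.+ 6 ℕ.* (threshold ℕ.* suc k′) ∎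
        where open ℕ.≤-Reasoning
      bound : ∀ N → threshold ≡ suc N → inv n * (inv threshold * toℚ (total (one q m k′ mq))) ≤ (+ 1 / 6) * (toℚ 5 + inv (suc k′)) + 1ℚ * inv n
      bound N eq = subst (λ z → inv n * (inv z * toℚ (total (one q m k′ mq))) ≤ (+ 1 / 6) * (toℚ 5 + inv (suc k′)) + 1ℚ * inv n) (sym eq)
        (gap-bound (suc m) N k′ (total (one q m k′ mq))
          (subst (λ z → 6 ℕ.* (total (one q m k′ mq) ℕ.* suc k′) ℕ.≤ (5 ℕ.* suc k′ ℕ.+ 1) ℕ.* (n ℕ.* z) ℕ.+ 6 ℕ.* (z ℕ.* suc k′)) eq numerators))

    cost-bound : (P : Cut k n) → IsKWayCut k n P → toℚ 1 ≤ cost k n P weight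
    cost-bound P isCut = subst (toℚ 1 ≤_) (sym (cost-linear {k} {n} {total} (total-linear q m) P (inv threshold)))
      (subst (_≤ inv threshold * toℚ (total (λ u v → d (P u) (P v)))) (unit (proj₁ threshold-positive) (proj₂ threshold-positive))
        (inv-mono threshold (toℚ-mono (CutBound.cut-bound mq P isCut))))
      where
      unit : ∀ N → threshold ≡ suc N → inv threshold * toℚ threshold ≡ toℚ 1
      unit N eq = trans (cong (λ z → inv z * toℚ z) eq) (inv-* N)

-- The theorem

open import Defs
open import Data.Nat using (ℕ; _∸_; _≤_) renaming (_<_ to _<ℕ_)
open import Data.Nat.Divisibility using (_∣_)
open import Data.Integer using (+_)
open import Data.Rational using (ℚ; _/_; _+_; _*_; _<_; 0ℚ) renaming (_≤_ to _≤ℚ_)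
open import Data.Product using (Σ; _×_)

import Data.Nat as ℕ
open import Data.Nat using (suc; s≤s)
open import Data.Nat.Divisibility using (divides)
open import Data.Product using (_,_)
open import Data.Rational using (1ℚ)
open import Data.Rational.Properties using (positive⁻¹)
open import Relation.Binary.PropositionalEquality using (refl)
open Combinatorics using (*3≡++)
open Rationals using (module Construction; 0≤inv*toℚ)

theorem8 : Σ ℚ (λ C → (0ℚ < C) ×
    ((n : ℕ) → 0 <ℕ n → 3 ∣ n → (k : ℕ) → 3 ≤ k →
    Σ (Weight k) (λ w →
    (∀ x y → 0ℚ ≤ℚ w x y) ×
    (LP k n w ≤ℚ ((+ 1 / 6) * (toℚ 5 + inv (k ∸ 1)) + C * inv n)) ×
    ((P : Cut k n) → IsKWayCut k n P → toℚ 1 ≤ℚ cost k n P w))))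
theorem8 = 1ℚ , positive⁻¹ 1ℚ , construct
  where
  construct : (n : ℕ) → 0 <ℕ n → 3 ∣ n → (k : ℕ) → 3 ≤ k →
    Σ (Weight k) (λ w →
    (∀ x y → 0ℚ ≤ℚ w x y) ×
    (LP k n w ≤ℚ ((+ 1 / 6) * (toℚ 5 + inv (k ∸ 1)) + 1ℚ * inv n)) ×
    ((P : Cut k n) → IsKWayCut k n P → toℚ 1 ≤ℚ cost k n P w))
  construct n 0<n (divides 0 refl) k 3≤k with 0<n
  ... | ()
  -- Here n is `suc j * 3`, which reduces to three successors of `j * 3`, so n - 2 is `suc (j * 3)`.
  construct n 0<n (divides (suc j) refl) (suc (suc k′)) (s≤s (s≤s _)) =
    C.weight , (λ x y → 0≤inv*toℚ C.threshold (C.count x y)) , C.LP-bound , C.cost-bound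
    where module C = Construction (suc j) (suc (j ℕ.* 3)) k′ (*3≡++ (suc j))
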